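{- Let $\alpha=(a_1,\ldots,a_k)$ be a composition of a positive integer $n$. Then \[\zeta_-(M_\alpha)=\begin{cases}\dfrac{(-1)^{k_e(\alpha)}}{2^{2\lfloor k_o(\alpha)/2\rfloor}}\,C\bigl(0,\lfloor k_o(\alpha)/2\rfloor\bigr) & \text{if } a_k \text{ is odd},\\ 0 & \text{if } a_k\text{ is even;}\end{cases}\] \[\zeta_+(M_\alpha)=\begin{cases}\dfrac{(-1)^{k_e(\alpha)+1}}{2^{k_o(\alpha)}}\,C\bigl(1,k_o(\alpha)/2-1\bigr) & \text{if } a_1 \text{ and } a_k \text{ are odd and } n \text{ is even},\\ 1 & \text{if } \alpha=(n) \text{ and } n \text{ is even},\\ 0&\text{otherwise.}\end{cases}\] Also $\zeta_-(1)=\zeta_+(1)=1$.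
   Context: $\Bbbk$ is a field of characteristic $\neq 2$. A composition $\alpha=(a_1,\ldots,a_k)$ of $n\ge 0$ is a sequence of positive integers with sum $|\alpha|=n$; $k(\alpha)=k$ is its number of parts, $k_e(\alpha)$ and $k_o(\alpha)$ its numbers of even and odd parts; $()$ is the empty composition. ${\mathcal{Q}Sym}$ is the Hopf algebra of quasi-symmetric functions over $\Bbbk$ (in variables $x_1,x_2,\ldots$), graded by degree and connected, with monomial basis $M_\alpha=\sum_{i_1<\cdots<i_k}x_{i_1}^{a_1}\cdots x_{i_k}^{a_k}$ ($M_{()}=1$), product the ordinary product, coproduct $\Delta(M_\alpha)=\sum_{i=0}^k M_{(a_1,\ldots,a_i)}\otimes M_{(a_{i+1},\ldots,a_k)}$ and counit $\epsilon(M_\alpha)=1$ if $\alpha=()$, $0$ otherwise. Convolution of functionals: $\rho\psi=m\circ(\rho\otimes\psi)\circ\Delta$. Characters are algebra morphisms ${\mathcal{Q}Sym}\to\Bbbk$; they form a group under convolution. For a functional $\varphi$, $\bar\varphi(h)=(-1)^n\varphi(h)$ on homogeneous $h$ of degree $n$; $\varphi$ is even if $\bar\varphi=\varphi$, odd if $\bar\varphi=\varphi^{ -1}$. Every character $\varphi$ factors uniquely as $\varphi=\varphi_+\varphi_-$ with $\varphi_+$ an even character and $\varphi_-$ an odd character. The universal character $\zeta$ is $\zeta(f)=f(1,0,0,\ldots)$; thus $\zeta(M_\alpha)=1$ if $\alpha=()$ or $\alpha=(n)$, and $0$ otherwise. $\zeta_+,\zeta_-$ denote its even and odd parts. The bivariate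 Catalan numbers are $C(m,n)=\frac{(2m)!(2n)!}{m!(m+n)!n!}$. -}

module Defs where

open import Level using (Level; _⊔_)
open import Algebra.Apartness.Bundles using (HeytingField; HeytingCommutativeRing)
open import Algebra.Bundles using (CommutativeRing; RawRing)
open import Algebra.Morphism.Structures using (module RingMorphisms)
import Algebra.Apartness.Properties.HeytingCommutativeRing as HeytingProperties
import Algebra.Definitions.RawSemiring as RawSemiringDefs
import Algebra.Properties.Ring as RingProperties
import Data.Nat as ℕ
open import Data.Nat using (ℕ; zero; suc; _≤_; _<_; _∸_; _<?_; s≤s⁻¹; NonZero; _!)
open import Data.Nat.DivMod using (_/_)
open import Data.Nat.Divisibility using (_∣_; _∤_; _∣?_)
open import Data.Nat.ListAction using (sum)
import Data.Nat.Properties as ℕₚ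
open import Data.Bool using (if_then_else_)
open import Data.List using (List; []; _∷_; [_]; map; concatMap; filter; foldr; head; inits; last; length; tails; upTo; zip)
open import Data.List.Properties using (≡-dec)
open import Data.List.Relation.Unary.All as All using (All; []; _∷_)
open import Data.List.Relation.Unary.All.Properties using (all-upTo)
import Data.Maybe.Relation.Unary.Any as Maybe
open import Data.Product using (_×_; _,_; proj₁)
open import Data.Sum using (_⊎_; inj₁; inj₂)
open import Function using (_∘_)
open import Relation.Nullary using (yes; no; ¬?)
open import Relation.Nullary.Decidable using (⌊_⌋)
open import Relation.Binary.PropositionalEquality as ≡ using (_≡_)

Even Odd : ℕ → Set
Even a = 2 ∣ a
Odd  a = 2 ∤ a

-- The division is exact: C (suc m) n + C m (suc n) = 4 C m n, and C 0 n is a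
-- central binomial coefficient, so every C m n is an integer.
C : ℕ → ℕ → ℕ
C m n = _/_ ((2 ℕ.* m) ! ℕ.* (2 ℕ.* n) !) (m ! ℕ.* (m ℕ.+ n) ! ℕ.* n !) {{nonZero}}
  where
  nonZero : NonZero (m ! ℕ.* (m ℕ.+ n) ! ℕ.* n !)
  nonZero = ℕₚ.m*n≢0 _ _ {{m ℕₚ.!* (m ℕ.+ n) !≢0}} {{n ℕₚ.!≢0}}

infix 4 _⊨_
_⊨_ : List ℕ → ℕ → Set
α ⊨ n = All (0 <_) α × sum α ≡ n

kₑ kₒ : List ℕ → ℕ
kₑ = length ∘ filter (2 ∣?_)
kₒ = length ∘ filter (λ a → ¬? (2 ∣? a))

FirstPart LastPart : (ℕ → Set) → List ℕ → Set
FirstPart P α = Maybe.Any P (head α)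
LastPart  P α = Maybe.Any P (last α)

-- Each composition of n, exactly once: a composition of suc n either starts
-- with 1, or its first part can be decreased.
compositions : ℕ → List (List ℕ)
compositions zero    = [ [] ]
compositions (suc n) = concatMap extend (compositions n)
  where
  extend : List ℕ → List (List ℕ)
  extend []      = [ 1 ∷ [] ]
  extend (a ∷ α) = (1 ∷ a ∷ α) ∷ (suc a ∷ α) ∷ []

compositionsUpTo : ℕ → List (List ℕ)
compositionsUpTo d = concatMap compositions (upTo (suc d))

-- ((a₁,…,aᵢ) , (aᵢ₊₁,…,aₖ)) for i = 0,…,k.
deconcatenations : List ℕ → List (List ℕ × List ℕ)
deconcatenations α = zip (inits α) (tails α)

nonzeros : List ℕ → List ℕ
nonzeros = filter (0 <?_)

sum-nonzeros : ∀ e → sum (nonzeros e) ≡ sum e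
sum-nonzeros []          = ≡.refl
sum-nonzeros (zero ∷ e)  = sum-nonzeros e
sum-nonzeros (suc a ∷ e) = ≡.cong (suc a ℕ.+_) (sum-nonzeros e)

module QuasiSymmetric {c ℓ₁ ℓ₂ : Level} (𝕜 : HeytingField c ℓ₁ ℓ₂) where

  open HeytingField 𝕜 renaming (Carrier to K)
  open HeytingCommutativeRing heytingCommutativeRing using (commutativeRing)
  open CommutativeRing commutativeRing using (ring; rawRing)
  open RawSemiringDefs (RawRing.rawSemiring rawRing) using (_^_) renaming (_×_ to _×ₙ_)
  open RingProperties ring using (-0#≈0#)
  open HeytingProperties heytingCommutativeRing using (1#0; x#0y#0→xy#0)
  open import Relation.Binary.Reasoning.Setoid setoid

  -- Apartness from 0 is invertibility, so this is "2 ≠ 0 in 𝕜".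
  Characteristic≢2 : Set ℓ₂
  Characteristic≢2 = 1# + 1# # 0#

  fromℕ : ℕ → K
  fromℕ n = n ×ₙ 1#

  [-1]^_ : ℕ → K
  [-1]^ n = (- 1#) ^ n

  ∑ : ∀ {a} {A : Set a} → List A → (A → K) → K
  ∑ xs f = foldr _+_ 0# (map f xs)

  module Halving (2#0 : Characteristic≢2) where

    2^n#0 : ∀ n → (1# + 1#) ^ n # 0#
    2^n#0 zero    = 1#0
    2^n#0 (suc n) = x#0y#0→xy#0 2#0 (2^n#0 n)

    infixl 7 _/2^_
    _/2^_ : K → ℕ → K
    x /2^ n = x * proj₁ (#⇒invertible (2^n#0 n))

  -- Formal power series in x₁, x₂, … are given by coefficient functions; the
  -- list (e₁,…,e_N) stands for the monomial x₁^e₁ ⋯ x_N^e_N.  The condition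
  -- quasisymmetric says that the coefficients of x_{i₁}^a₁ ⋯ x_{iₖ}^aₖ and
  -- x_{j₁}^a₁ ⋯ x_{jₖ}^aₖ agree for all i₁ < ⋯ < iₖ and j₁ < ⋯ < jₖ; it also
  -- makes coeff insensitive to trailing zeros.
  record QSym : Set (c ⊔ ℓ₁) where
    field
      coeff          : List ℕ → K
      quasisymmetric : ∀ e e′ → nonzeros e ≡ nonzeros e′ → coeff e ≈ coeff e′
      bound          : ℕ
      bounded        : ∀ e → bound < sum e → coeff e ≈ 0#

  open QSym public

  infix 4 _≈Q_
  _≈Q_ : QSym → QSym → Set ℓ₁
  f ≈Q g = ∀ e → coeff f e ≈ coeff g e

  M : List ℕ → QSym
  M α = record
    { coeff          = δ
    ; quasisymmetric = λ e e′ eq → reflexive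
        (≡.cong (λ β → if ⌊ ≡-dec ℕ._≟_ β α ⌋ then 1# else 0#) eq)
    ; bound          = sum α
    ; bounded        = vanish
    }
    where
    δ : List ℕ → K
    δ e = if ⌊ ≡-dec ℕ._≟_ (nonzeros e) α ⌋ then 1# else 0#

    vanish : ∀ e → sum α < sum e → δ e ≈ 0#
    vanish e α<e with ≡-dec ℕ._≟_ (nonzeros e) α
    ... | no _       = refl
    ... | yes ≡.refl with () ← ℕₚ.<-irrefl (sum-nonzeros e) α<e

  0Q 1Q : QSym
  0Q = record
    { coeff = λ _ → 0# ; quasisymmetric = λ _ _ _ → refl
    ; bound = 0 ; bounded = λ _ _ → refl }
  1Q = M []

  infixl 6 _+Q_
  _+Q_ : QSym → QSym → QSym
  f +Q g = record
    { coeff          = λ e → coeff f e + coeff g e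
    ; quasisymmetric = λ e e′ eq → +-cong (quasisymmetric f e e′ eq) (quasisymmetric g e e′ eq)
    ; bound          = bound f ℕ.⊔ bound g
    ; bounded        = λ e b<e → trans
        (+-cong (bounded f e (ℕₚ.≤-<-trans (ℕₚ.m≤m⊔n (bound f) (bound g)) b<e))
                (bounded g e (ℕₚ.≤-<-trans (ℕₚ.m≤n⊔m (bound f) (bound g)) b<e)))
        (+-identityˡ 0#)
    }

  infix 8 -Q_
  -Q_ : QSym → QSym
  -Q f = record
    { coeff          = λ e → - coeff f e
    ; quasisymmetric = λ e e′ eq → -‿cong (quasisymmetric f e e′ eq)
    ; bound          = bound f
    ; bounded        = λ e b<e → trans (-‿cong (bounded f e b<e)) -0#≈0#
    }

  infixr 7 _•_
  _•_ : K → QSym → QSym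
  x • f = record
    { coeff          = λ e → x * coeff f e
    ; quasisymmetric = λ e e′ eq → *-congˡ (quasisymmetric f e e′ eq)
    ; bound          = bound f
    ; bounded        = λ e b<e → trans (*-congˡ (bounded f e b<e)) (zeroʳ x)
    }

  -- ∑-factorizations F e sums F u v over all ways of writing the monomial e as
  -- a product of monomials u and v, i.e. e = u + v componentwise.
  ∑-factorizations : (List ℕ → List ℕ → K) → List ℕ → K
  ∑-factorizations F []      = F [] []
  ∑-factorizations F (a ∷ e) =
    ∑ (upTo (suc a)) λ i → ∑-factorizations (λ u v → F (i ∷ u) (a ∸ i ∷ v)) e

  ∑-cong : ∀ {a} {A : Set a} (xs : List A) {f g : A → K} →
           (∀ x → f x ≈ g x) → ∑ xs f ≈ ∑ xs g
  ∑-cong []       f≈g = refl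
  ∑-cong (x ∷ xs) f≈g = +-cong (f≈g x) (∑-cong xs f≈g)

  ∑-zero : ∀ {a} {A : Set a} {xs : List A} {f : A → K} →
           All (λ x → f x ≈ 0#) xs → ∑ xs f ≈ 0#
  ∑-zero []       = refl
  ∑-zero (p ∷ ps) = trans (+-cong p (∑-zero ps)) (+-identityˡ 0#)

  ∑-factorizations-cong : ∀ {F G} → (∀ u v → F u v ≈ G u v) →
    ∀ e → ∑-factorizations F e ≈ ∑-factorizations G e
  ∑-factorizations-cong F≈G []      = F≈G [] []
  ∑-factorizations-cong F≈G (a ∷ e) =
    ∑-cong (upTo (suc a)) λ i → ∑-factorizations-cong (λ u v → F≈G _ _) e

  Invariant : (List ℕ → List ℕ → K) → Set ℓ₁
  Invariant F = ∀ {u u′ v v′} → nonzeros u ≡ nonzeros u′ → nonzeros v ≡ nonzeros v′ →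
                F u v ≈ F u′ v′

  nonzeros-∷ : ∀ i {u u′} → nonzeros u ≡ nonzeros u′ → nonzeros (i ∷ u) ≡ nonzeros (i ∷ u′)
  nonzeros-∷ zero    eq = eq
  nonzeros-∷ (suc i) eq = ≡.cong (suc i ∷_) eq

  ∑-factorizations-nonzeros : ∀ {F} → Invariant F → ∀ e →
    ∑-factorizations F e ≈ ∑-factorizations F (nonzeros e)
  ∑-factorizations-nonzeros inv []         = refl
  ∑-factorizations-nonzeros inv (zero ∷ e) =
    trans (+-identityʳ _)
      (trans (∑-factorizations-cong (λ u v → inv ≡.refl ≡.refl) e)
             (∑-factorizations-nonzeros inv e))
  ∑-factorizations-nonzeros inv (suc a ∷ e) = ∑-cong (upTo (suc (suc a))) λ i →
    ∑-factorizations-nonzeros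
      (λ p q → inv (nonzeros-∷ i p) (nonzeros-∷ (suc a ∸ i) q)) e

  sum-split : ∀ {a i s t r} → i ≤ a → s ℕ.+ t ≡ r →
              (i ℕ.+ s) ℕ.+ ((a ∸ i) ℕ.+ t) ≡ a ℕ.+ r
  sum-split {a} {i} {s} {t} i≤a ≡.refl =
    ≡.trans (ℕₚ.+-assoc i s _)
    (≡.trans (≡.cong (i ℕ.+_) (≡.trans (≡.sym (ℕₚ.+-assoc s (a ∸ i) t))
                              (≡.trans (≡.cong (ℕ._+ t) (ℕₚ.+-comm s (a ∸ i)))
                                       (ℕₚ.+-assoc (a ∸ i) s t))))
    (≡.trans (≡.sym (ℕₚ.+-assoc i (a ∸ i) (s ℕ.+ t)))
             (≡.cong (ℕ._+ (s ℕ.+ t)) (ℕₚ.m+[n∸m]≡n i≤a))))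

  ∑-factorizations-zero : ∀ {F} e → (∀ u v → sum u ℕ.+ sum v ≡ sum e → F u v ≈ 0#) →
    ∑-factorizations F e ≈ 0#
  ∑-factorizations-zero []      F≈0 = F≈0 [] [] ≡.refl
  ∑-factorizations-zero {F} (a ∷ e) F≈0 = ∑-zero (All.map step (all-upTo (suc a)))
    where
    step : ∀ {i} → i < suc a → ∑-factorizations (λ u v → F (i ∷ u) (a ∸ i ∷ v)) e ≈ 0#
    step {i} i<1+a = ∑-factorizations-zero e λ u v eq →
      F≈0 (i ∷ u) (a ∸ i ∷ v) (sum-split {s = sum u} (s≤s⁻¹ i<1+a) eq)

  exceeds : ∀ {b b′ s t} → b ℕ.+ b′ < s ℕ.+ t → b < s ⊎ b′ < t
  exceeds {b} {b′} {s} {t} lt with b <? s | b′ <? t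
  ... | yes p | _     = inj₁ p
  ... | no _  | yes q = inj₂ q
  ... | no p  | no q  with () ← ℕₚ.<⇒≱ lt (ℕₚ.+-mono-≤ (ℕₚ.≮⇒≥ p) (ℕₚ.≮⇒≥ q))

  infixl 7 _*Q_
  _*Q_ : QSym → QSym → QSym
  f *Q g = record
    { coeff          = ∑-factorizations F
    ; quasisymmetric = λ e e′ eq → begin
        ∑-factorizations F e              ≈⟨ ∑-factorizations-nonzeros inv e ⟩
        ∑-factorizations F (nonzeros e)   ≡⟨ ≡.cong (∑-factorizations F) eq ⟩
        ∑-factorizations F (nonzeros e′)  ≈⟨ ∑-factorizations-nonzeros inv e′ ⟨
        ∑-factorizations F e′             ∎
    ; bound          = bound f ℕ.+ bound g
    ; bounded        = λ e b<e → ∑-factorizations-zero e λ u v eq →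
        vanish u v (exceeds (≡.subst (bound f ℕ.+ bound g <_) (≡.sym eq) b<e))
    }
    where
    F : List ℕ → List ℕ → K
    F u v = coeff f u * coeff g v

    inv : Invariant F
    inv p q = *-cong (quasisymmetric f _ _ p) (quasisymmetric g _ _ q)

    vanish : ∀ u v → bound f < sum u ⊎ bound g < sum v → F u v ≈ 0#
    vanish u v (inj₁ p) = trans (*-congʳ (bounded f u p)) (zeroˡ _)
    vanish u v (inj₂ q) = trans (*-congˡ (bounded g v q)) (zeroʳ _)

  qsymRawRing : RawRing (c ⊔ ℓ₁) ℓ₁
  qsymRawRing = record
    { Carrier = QSym ; _≈_ = _≈Q_ ; _+_ = _+Q_ ; _*_ = _*Q_
    ; -_ = -Q_ ; 0# = 0Q ; 1# = 1Q }

  component : ℕ → QSym → QSym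
  component n f = record
    { coeff          = fₙ
    ; quasisymmetric = invariant
    ; bound          = bound f
    ; bounded        = vanish
    }
    where
    fₙ : List ℕ → K
    fₙ e = if ⌊ sum e ℕ.≟ n ⌋ then coeff f e else 0#

    invariant : ∀ e e′ → nonzeros e ≡ nonzeros e′ → fₙ e ≈ fₙ e′
    invariant e e′ eq
      rewrite ≡.trans (≡.sym (sum-nonzeros e)) (≡.trans (≡.cong sum eq) (sum-nonzeros e′))
      with sum e′ ℕ.≟ n
    ... | yes _ = quasisymmetric f e e′ eq
    ... | no _  = refl

    vanish : ∀ e → bound f < sum e → fₙ e ≈ 0#
    vanish e b<e with sum e ℕ.≟ n
    ... | yes _ = bounded f e b<e
    ... | no _  = refl

  -- An element of QSym ⊗ QSym is represented by a formal sum of pure tensors,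
  -- without quotienting: only values ρ ⊗ ψ of linear functionals are taken.
  -- Since f = ∑ coeff f α • M α over the compositions α of size at most
  -- bound f, this is the linear extension of
  -- Δ(M α) = ∑ᵢ M (a₁,…,aᵢ) ⊗ M (aᵢ₊₁,…,aₖ).
  Δ : QSym → List (QSym × QSym)
  Δ f = concatMap
    (λ α → map (λ (β , γ) → coeff f α • M β , M γ) (deconcatenations α))
    (compositionsUpTo (bound f))

  Functional : Set (c ⊔ ℓ₁)
  Functional = QSym → K

  infix 4 _≐_
  _≐_ : Functional → Functional → Set (c ⊔ ℓ₁)
  φ ≐ ψ = ∀ f → φ f ≈ ψ f

  infixl 7 _✶_
  _✶_ : Functional → Functional → Functional
  (ρ ✶ ψ) f = ∑ (Δ f) λ (g , h) → ρ g * ψ h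

  -- The counit, which is the unit for convolution: ε f is the coefficient of
  -- M () in f.
  ε : Functional
  ε f = coeff f []

  record IsCharacter (φ : Functional) : Set (c ⊔ ℓ₁) where
    open RingMorphisms qsymRawRing rawRing using (IsRingHomomorphism)
    field
      isRingHomomorphism : IsRingHomomorphism φ
      •-homo             : ∀ x f → φ (x • f) ≈ x * φ f

  bar : Functional → Functional
  bar φ f = ∑ (upTo (suc (bound f))) λ n → [-1]^ n * φ (component n f)

  IsEven IsOdd : Functional → Set (c ⊔ ℓ₁)
  IsEven φ = bar φ ≐ φ
  IsOdd  φ = (bar φ ✶ φ ≐ ε) × (φ ✶ bar φ ≐ ε)

  -- f (1,0,0,…): among the monomials only the powers of x₁ survive.
  ζ : Functional
  ζ f = ∑ (upTo (suc (bound f))) λ n → coeff f [ n ]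

  record IsEvenOddFactorization (φ φ₊ φ₋ : Functional) : Set (c ⊔ ℓ₁) where
    field
      character₊    : IsCharacter φ₊
      character₋    : IsCharacter φ₋
      even          : IsEven φ₊
      odd           : IsOdd φ₋
      factorization : φ ≐ φ₊ ✶ φ₋

{-# OPTIONS --safe #-}

-- Put a = ζ₋ ∘ M and b = ζ₊ ∘ M, functions on compositions under the convolution
-- ⋆ dual to deconcatenation, and write f̄ α = (-1)^|α| f α.  Oddness says
-- ā ⋆ a = δ, so ζ̄ = b ⋆ ā gives b = ζ̄ ⋆ a, that is
--   b (x,α) = a (x,α) + (-1)^x a α.
-- If x + |α| is odd, b (x,α) = 0 determines a (x,α) from a α; if it is even,
-- ā ⋆ a = δ determines 2 a (x,α) from shorter compositions.  So a is the only
-- solution of these equations, and it remains to check them for the formula.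
-- The formula is the image of d(t) = ∑ C(0,⌊k/2⌋) 4^(-⌊k/2⌋) t^k under an algebra
-- map from power series to functions on compositions which turns t ↦ -t into
-- f ↦ f̄.  The even coefficients of d(-t) d(t) in positive degree are differences
-- of consecutive coefficients of (∑ C(0,m) 4^(-m) t^m)² = 1/(1 - t), so they vanish.

module Submission where

open import Defs
open import Algebra.Apartness.Bundles using (HeytingField; HeytingCommutativeRing)
import Algebra.Apartness.Properties.HeytingCommutativeRing as HeytingProperties
open import Algebra.Bundles using (CommutativeRing; CommutativeSemiring; RawRing)
import Algebra.Definitions.RawSemiring as RawSemiringDefs
open import Algebra.Morphism.Structures using (module RingMorphisms)
import Algebra.Properties.CommutativeSemigroup as CommutativeSemigroupProperties
import Algebra.Properties.Ring as RingProperties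
import Algebra.Properties.Semiring.Exp as Exp
import Algebra.Properties.Semiring.Mult as Mult
import Algebra.Solver.Ring.NaturalCoefficients.Default as Solver
open import Data.List using (List; []; _∷_; [_]; _++_; map; concatMap; inits; tails; zip; length; applyUpTo; upTo)
open import Data.List.Properties using (≡-dec; length-++; filter-accept; filter-reject)
open import Data.List.Relation.Unary.All as All using (All; []; _∷_)
open import Data.List.Relation.Unary.All.Properties using (++⁻)
import Data.Maybe.Relation.Unary.Any as Maybe
import Data.Nat as ℕ
open import Data.Nat using (ℕ; zero; suc; _∸_; _≤_; _<_; s≤s; z<s; _!) renaming (_*_ to _·_)
open import Data.Nat.Combinatorics using (k![n∸k]!∣n!)
open import Data.Nat.DivMod using (_/_; m*n/n≡m; m/n*n≡m; +-distrib-/-∣ʳ; /-congˡ)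
open import Data.Nat.Divisibility using (_∣_; _∣?_; _∣0; divides; ∣m∣n⇒∣m+n; ∣m+n∣m⇒∣n; n∣m*n; m∣m*n)
open import Data.Nat.ListAction using (sum)
open import Data.Nat.ListAction.Properties using (sum-++)
import Data.Nat.Properties as ℕₚ
open import Data.Nat.Tactic.RingSolver using (solve-∀)
open import Data.Product using (∃; _×_; _,_; proj₁; proj₂)
open import Data.Sum using (_⊎_; inj₁; inj₂)
open import Function using (_∘_)
open import Relation.Nullary using (Dec; yes; no; ¬_; ¬?; contradiction)
open import Relation.Binary.PropositionalEquality as ≡ using (_≡_; _≢_)

-- Parity of natural numbers.

even⊎odd : ∀ n → (∃ λ m → n ≡ 2 ℕ.* m) ⊎ (∃ λ m → n ≡ suc (2 ℕ.* m))
even⊎odd zero = inj₁ (0 , ≡.refl)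
even⊎odd (suc n) with even⊎odd n
... | inj₁ (m , ≡.refl) = inj₂ (m , ≡.refl)
... | inj₂ (m , ≡.refl) = inj₁ (suc m , ≡.sym (ℕₚ.*-suc 2 m))

odd-1+2* : ∀ m → Odd (suc (2 ℕ.* m))
odd-1+2* m 2∣ with ∣m+n∣m⇒∣n (≡.subst (2 ∣_) (ℕₚ.+-comm 1 (2 ℕ.* m)) 2∣) (m∣m*n m)
... | divides zero ()
... | divides (suc _) ()

even⇒2* : ∀ {n} → Even n → ∃ λ m → n ≡ 2 ℕ.* m
even⇒2* (divides m eq) = m , ≡.trans eq (ℕₚ.*-comm m 2)

odd⇒1+2* : ∀ {n} → Odd n → ∃ λ m → n ≡ suc (2 ℕ.* m)
odd⇒1+2* {n} odd with even⊎odd n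
... | inj₁ (m , ≡.refl) = contradiction (m∣m*n m) odd
... | inj₂ view = view

odd+odd : ∀ {m n} → Odd m → Odd n → Even (m ℕ.+ n)
odd+odd om on with odd⇒1+2* om | odd⇒1+2* on
... | m , ≡.refl | n , ≡.refl = divides (suc (m ℕ.+ n)) (lemma m n)
  where
  lemma : ∀ m n → suc (2 ℕ.* m) ℕ.+ suc (2 ℕ.* n) ≡ suc (m ℕ.+ n) ℕ.* 2
  lemma = solve-∀

even-suc⇒odd : ∀ {n} → Even (suc n) → Odd n
even-suc⇒odd {n} even even′ with even⇒2* even′
... | m , ≡.refl = odd-1+2* m even

2*m/2≡m : ∀ m → (2 ℕ.* m) / 2 ≡ m
2*m/2≡m m = ≡.trans (/-congˡ (ℕₚ.*-comm 2 m)) (m*n/n≡m m 2)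

[1+2*m]/2≡m : ∀ m → suc (2 ℕ.* m) / 2 ≡ m
[1+2*m]/2≡m m = ≡.trans (+-distrib-/-∣ʳ 1 {d = 2} (m∣m*n m)) (2*m/2≡m m)

-- Recurrences for the bivariate Catalan numbers C(0,m) and C(1,m).

C₀-factorials : ∀ m → C 0 m ℕ.* (1 ℕ.* m ! ℕ.* m !) ≡ 1 ℕ.* (2 ℕ.* m) !
C₀-factorials m = m/n*n≡m {{ℕₚ.m*n≢0 _ _ {{0 ℕₚ.!* m !≢0}} {{m ℕₚ.!≢0}}}} divisible
  where
  divisible : 1 ℕ.* m ! ℕ.* m ! ∣ 1 ℕ.* (2 ℕ.* m) !
  -- The divisor is m! (2m - m)!, as for a central binomial coefficient; the factors 1 are the
  -- values of 0! in the definition of `C`.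
  divisible = ≡.subst₂ _∣_
    (≡.cong₂ ℕ._*_ (≡.sym (ℕₚ.*-identityˡ (m !)))
      (≡.cong _! (≡.trans (ℕₚ.m+n∸m≡n m (m ℕ.+ 0)) (ℕₚ.+-identityʳ m))))
    (≡.sym (ℕₚ.*-identityˡ _))
    (k![n∸k]!∣n! {2 ℕ.* m} {m} (ℕₚ.m≤m+n m _))

[2+2m]! : ∀ m → (2 ℕ.* suc m) ! ≡ suc (suc (2 ℕ.* m)) ℕ.* (suc (2 ℕ.* m) ℕ.* (2 ℕ.* m) !)
[2+2m]! m = ≡.cong _! (ℕₚ.*-suc 2 m)

-- After multiplication by (m + 1) m! m!, the left side contains the denominator of `C 0 (suc m)`
-- and the right side that of `C 0 m`, so `C₀-factorials` turns both into factorials.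
C₀-suc : ∀ m → suc m ℕ.* C 0 (suc m) ≡ 2 ℕ.* suc (2 ℕ.* m) ℕ.* C 0 m
C₀-suc m = ℕₚ.*-cancelʳ-≡ _ _ (suc m ℕ.* (m ! ℕ.* m !))
  {{ℕₚ.m*n≢0 (suc m) _ {{_}} {{m ℕₚ.!* m !≢0}}}} (begin
  suc m ℕ.* C 0 (suc m) ℕ.* (suc m ℕ.* (m ! ℕ.* m !))
    ≡⟨ lhs m (m !) (C 0 (suc m)) ⟩
  C 0 (suc m) ℕ.* (1 ℕ.* (suc m) ! ℕ.* (suc m) !)
    ≡⟨ C₀-factorials (suc m) ⟩
  1 ℕ.* (2 ℕ.* suc m) !
    ≡⟨ ≡.cong (1 ℕ.*_) ([2+2m]! m) ⟩
  1 ℕ.* (suc (suc (2 ℕ.* m)) ℕ.* (suc (2 ℕ.* m) ℕ.* (2 ℕ.* m) !))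
    ≡⟨ mid m ((2 ℕ.* m) !) ⟩
  suc (suc (2 ℕ.* m)) ℕ.* suc (2 ℕ.* m) ℕ.* (1 ℕ.* (2 ℕ.* m) !)
    ≡⟨ ≡.cong (suc (suc (2 ℕ.* m)) ℕ.* suc (2 ℕ.* m) ℕ.*_) (C₀-factorials m) ⟨
  suc (suc (2 ℕ.* m)) ℕ.* suc (2 ℕ.* m) ℕ.* (C 0 m ℕ.* (1 ℕ.* m ! ℕ.* m !))
    ≡⟨ rhs m (m !) (C 0 m) ⟩
  2 ℕ.* suc (2 ℕ.* m) ℕ.* C 0 m ℕ.* (suc m ℕ.* (m ! ℕ.* m !)) ∎)
  where
  open ≡.≡-Reasoning
  lhs : ∀ m f c → suc m ℕ.* c ℕ.* (suc m ℕ.* (f ℕ.* f)) ≡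
        c ℕ.* (1 ℕ.* (suc m ℕ.* f) ℕ.* (suc m ℕ.* f))
  lhs = solve-∀
  mid : ∀ m f → 1 ℕ.* (suc (suc (2 ℕ.* m)) ℕ.* (suc (2 ℕ.* m) ℕ.* f)) ≡
        suc (suc (2 ℕ.* m)) ℕ.* suc (2 ℕ.* m) ℕ.* (1 ℕ.* f)
  mid = solve-∀
  rhs : ∀ m f c → suc (suc (2 ℕ.* m)) ℕ.* suc (2 ℕ.* m) ℕ.* (c ℕ.* (1 ℕ.* f ℕ.* f)) ≡
        2 ℕ.* suc (2 ℕ.* m) ℕ.* c ℕ.* (suc m ℕ.* (f ℕ.* f))
  rhs = solve-∀

-- The denominator `d` of `C 1 m` divides `C 0 (suc m) ℕ.* d`, so this product can be moved inside
-- the truncated quotient; the numerator then becomes `4 ℕ.* C 0 m ℕ.* d`.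
C₁+C₀ : ∀ m → C 1 m ℕ.+ C 0 (suc m) ≡ 4 ℕ.* C 0 m
C₁+C₀ m = begin
  C 1 m ℕ.+ C 0 (suc m)
    ≡⟨ ≡.cong (C 1 m ℕ.+_) (m*n/n≡m (C 0 (suc m)) d {{d≢0}}) ⟨
  C 1 m ℕ.+ _/_ (C 0 (suc m) ℕ.* d) d {{d≢0}}
    ≡⟨ +-distrib-/-∣ʳ _ {{d≢0}} (n∣m*n (C 0 (suc m))) ⟨
  _/_ ((2 ℕ.* 1) ! ℕ.* (2 ℕ.* m) ! ℕ.+ C 0 (suc m) ℕ.* d) d {{d≢0}}
    ≡⟨ /-congˡ {{d≢0}} numerator ⟩
  _/_ (4 ℕ.* C 0 m ℕ.* d) d {{d≢0}}
    ≡⟨ m*n/n≡m (4 ℕ.* C 0 m) d {{d≢0}} ⟩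
  4 ℕ.* C 0 m ∎
  where
  open ≡.≡-Reasoning
  d : ℕ
  d = 1 ! ℕ.* (1 ℕ.+ m) ! ℕ.* m !
  d≢0 : ℕ.NonZero d
  d≢0 = ℕₚ.m*n≢0 _ _ {{1 ℕₚ.!* suc m !≢0}} {{m ℕₚ.!≢0}}
  first : ∀ f → 2 ℕ.* f ≡ 2 ℕ.* (1 ℕ.* f)
  first = solve-∀
  second : ∀ m f c → c ℕ.* (1 ℕ.* (suc m ℕ.* f) ℕ.* f) ≡ suc m ℕ.* c ℕ.* (f ℕ.* f)
  second = solve-∀
  third : ∀ m f c → 2 ℕ.* (c ℕ.* (1 ℕ.* f ℕ.* f)) ℕ.+ 2 ℕ.* suc (2 ℕ.* m) ℕ.* c ℕ.* (f ℕ.* f) ≡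
          4 ℕ.* c ℕ.* (1 ℕ.* (suc m ℕ.* f) ℕ.* f)
  third = solve-∀
  numerator : (2 ℕ.* 1) ! ℕ.* (2 ℕ.* m) ! ℕ.+ C 0 (suc m) ℕ.* d ≡ 4 ℕ.* C 0 m ℕ.* d
  numerator = ≡.trans (≡.cong₂ ℕ._+_
      (≡.trans (first ((2 ℕ.* m) !)) (≡.cong (2 ℕ.*_) (≡.sym (C₀-factorials m))))
      (≡.trans (second m (m !) (C 0 (suc m))) (≡.cong (ℕ._* (m ! ℕ.* m !)) (C₀-suc m))))
    (third m (m !) (C 0 m))

-- Cauchy products of sequences over a commutative semiring.

module CauchyProduct {c ℓ} (R : CommutativeSemiring c ℓ) where

  open CommutativeSemiring R
  open RawSemiringDefs rawSemiring using (_^_)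
  open CommutativeSemigroupProperties +-commutativeSemigroup
    using () renaming (interchange to +-interchange)
  open CommutativeSemigroupProperties *-commutativeSemigroup
    using () renaming (interchange to *-interchange; x∙yz≈y∙xz to x*yz≈y*xz)
  open import Relation.Binary.Reasoning.Setoid setoid

  infixl 7 _⊛_
  -- Splitting off the constant coefficient of the first factor avoids subtraction of indices and
  -- matches the recursion of `_⋆_` on lists.
  _⊛_ : (ℕ → Carrier) → (ℕ → Carrier) → ℕ → Carrier
  (f ⊛ g) zero    = f 0 * g 0
  (f ⊛ g) (suc n) = f 0 * g (suc n) + (f ∘ suc ⊛ g) n

  ⊛-cong : ∀ {f f′ g g′} → (∀ i → f i ≈ f′ i) → (∀ i → g i ≈ g′ i) →
           ∀ n → (f ⊛ g) n ≈ (f′ ⊛ g′) n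
  ⊛-cong p q zero    = *-cong (p 0) (q 0)
  ⊛-cong p q (suc n) = +-cong (*-cong (p 0) (q (suc n))) (⊛-cong (p ∘ suc) q n)

  -- The mirror image of the defining recursion, needed for commutativity.
  ⊛-sucʳ : ∀ f g n → (f ⊛ g) (suc n) ≈ f (suc n) * g 0 + (f ⊛ g ∘ suc) n
  ⊛-sucʳ f g zero    = +-comm _ _
  ⊛-sucʳ f g (suc n) = begin
    f 0 * g (suc (suc n)) + (f ∘ suc ⊛ g) (suc n)
      ≈⟨ +-congˡ (⊛-sucʳ (f ∘ suc) g n) ⟩
    f 0 * g (suc (suc n)) + (f (suc (suc n)) * g 0 + (f ∘ suc ⊛ g ∘ suc) n)
      ≈⟨ x∙yz≈y∙xz _ _ _ ⟩
    f (suc (suc n)) * g 0 + (f 0 * g (suc (suc n)) + (f ∘ suc ⊛ g ∘ suc) n) ∎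
    where open CommutativeSemigroupProperties +-commutativeSemigroup using (x∙yz≈y∙xz)

  ⊛-comm : ∀ f g n → (f ⊛ g) n ≈ (g ⊛ f) n
  ⊛-comm f g zero    = *-comm _ _
  ⊛-comm f g (suc n) =
    trans (+-cong (*-comm _ _) (⊛-comm (f ∘ suc) g n)) (sym (⊛-sucʳ g f n))

  ⊛-distribʳ : ∀ f f′ g n → ((λ i → f i + f′ i) ⊛ g) n ≈ (f ⊛ g) n + (f′ ⊛ g) n
  ⊛-distribʳ f f′ g zero    = distribʳ _ _ _
  ⊛-distribʳ f f′ g (suc n) =
    trans (+-cong (distribʳ _ _ _) (⊛-distribʳ (f ∘ suc) (f′ ∘ suc) g n)) (+-interchange _ _ _ _)

  ⊛-*ˡ : ∀ x f g n → ((λ i → x * f i) ⊛ g) n ≈ x * (f ⊛ g) n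
  ⊛-*ˡ x f g zero    = *-assoc _ _ _
  ⊛-*ˡ x f g (suc n) =
    trans (+-cong (*-assoc _ _ _) (⊛-*ˡ x (f ∘ suc) g n)) (sym (distribˡ _ _ _))

  -- Substituting x t for t is multiplicative on power series in t.
  ⊛-^ : ∀ x f g n → ((λ i → f i * x ^ i) ⊛ (λ i → g i * x ^ i)) n ≈ (f ⊛ g) n * x ^ n
  ⊛-^ x f g zero    = trans (*-interchange _ _ _ _) (*-congˡ (*-identityˡ 1#))
  ⊛-^ x f g (suc n) = begin
    f 0 * 1# * (g (suc n) * x ^ suc n) + ((λ i → f (suc i) * (x * x ^ i)) ⊛ gˣ) n
      ≈⟨ +-cong (trans (*-interchange _ _ _ _) (*-congˡ (*-identityˡ _)))
                (trans (⊛-cong (λ i → x*yz≈y*xz _ _ _) (λ _ → refl) n) (⊛-*ˡ x _ gˣ n)) ⟩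
    f 0 * g (suc n) * x ^ suc n + x * ((λ i → f (suc i) * x ^ i) ⊛ gˣ) n
      ≈⟨ +-congˡ (trans (*-congˡ (⊛-^ x (f ∘ suc) g n)) (x*yz≈y*xz _ _ _)) ⟩
    f 0 * g (suc n) * x ^ suc n + (f ∘ suc ⊛ g) n * x ^ suc n
      ≈⟨ distribʳ _ _ _ ⟨
    (f ⊛ g) (suc n) * x ^ suc n ∎
    where
    gˣ : ℕ → Carrier
    gˣ i = g i * x ^ i

-- The square of the central binomial series over the natural numbers.

module ℕ-CauchyProduct = CauchyProduct ℕₚ.+-*-commutativeSemiring

module _ where
  open ℕ-CauchyProduct
  open ≡.≡-Reasoning

  -- θ is the derivation t d/dt of power series; applied to (∑ C(0,m) t^m)², it turns
  -- the recurrence C₀-suc into (n + 1) Sₙ₊₁ = 4 (n + 1) Sₙ.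
  θ : (ℕ → ℕ) → ℕ → ℕ
  θ f i = i ℕ.* f i

  -- The Leibniz rule: the indices of the two factors in each term add up to n.
  θ-⊛ : ∀ f g n → (θ f ⊛ g) n ℕ.+ (f ⊛ θ g) n ≡ n ℕ.* (f ⊛ g) n
  θ-⊛ f g zero    = ℕₚ.*-zeroʳ (f 0)
  θ-⊛ f g (suc n) = begin
    -- By computation, the shift of `θ f` is `f′` plus `θ f′`, and its constant coefficient is 0.
    ((λ i → f′ i ℕ.+ θ f′ i) ⊛ g) n ℕ.+ (f 0 ℕ.* (suc n ℕ.* g (suc n)) ℕ.+ (f′ ⊛ θ g) n)
      ≡⟨ ≡.cong (ℕ._+ (f 0 ℕ.* (suc n ℕ.* g (suc n)) ℕ.+ (f′ ⊛ θ g) n))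
         (⊛-distribʳ f′ (θ f′) g n) ⟩
    (f′ ⊛ g) n ℕ.+ (θ f′ ⊛ g) n ℕ.+ (f 0 ℕ.* (suc n ℕ.* g (suc n)) ℕ.+ (f′ ⊛ θ g) n)
      ≡⟨ regroup (f 0) (g (suc n)) n ((f′ ⊛ g) n) _ _ ⟩
    suc n ℕ.* (f 0 ℕ.* g (suc n)) ℕ.+ ((f′ ⊛ g) n ℕ.+ ((θ f′ ⊛ g) n ℕ.+ (f′ ⊛ θ g) n))
      ≡⟨ ≡.cong (λ s → suc n ℕ.* (f 0 ℕ.* g (suc n)) ℕ.+ ((f′ ⊛ g) n ℕ.+ s)) (θ-⊛ f′ g n) ⟩
    suc n ℕ.* (f 0 ℕ.* g (suc n)) ℕ.+ suc n ℕ.* (f′ ⊛ g) n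
      ≡⟨ ℕₚ.*-distribˡ-+ (suc n) (f 0 ℕ.* g (suc n)) _ ⟨
    suc n ℕ.* (f ⊛ g) (suc n) ∎
    where
    f′ : ℕ → ℕ
    f′ = f ∘ suc
    regroup : ∀ a b n s t u → s ℕ.+ t ℕ.+ (a ℕ.* (suc n ℕ.* b) ℕ.+ u) ≡
              suc n ℕ.* (a ℕ.* b) ℕ.+ (s ℕ.+ (t ℕ.+ u))
    regroup = solve-∀

  -- The common factor `suc n` is cancelled over the natural numbers, because its image in a field
  -- of positive characteristic can be zero.
  C₀⊛C₀-suc : ∀ n → (C 0 ⊛ C 0) (suc n) ≡ 4 ℕ.* (C 0 ⊛ C 0) n
  C₀⊛C₀-suc n = ℕₚ.*-cancelˡ-≡ _ _ (suc n) (begin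
    suc n ℕ.* S (suc n)
      ≡⟨ θ-⊛ B B (suc n) ⟨
    (θ B ⊛ B) (suc n) ℕ.+ (B ⊛ θ B) (suc n)
      ≡⟨ ≡.cong₂ ℕ._+_ shift (≡.trans (⊛-comm B (θ B) (suc n)) shift) ⟩
    T ℕ.+ T
      ≡⟨ ≡.cong (λ x → (4 ℕ.* (θ B ⊛ B) n ℕ.+ 2 ℕ.* S n) ℕ.+ (4 ℕ.* x ℕ.+ 2 ℕ.* S n)) (⊛-comm (θ B) B n) ⟩
    (4 ℕ.* (θ B ⊛ B) n ℕ.+ 2 ℕ.* S n) ℕ.+ (4 ℕ.* (B ⊛ θ B) n ℕ.+ 2 ℕ.* S n)
      ≡⟨ regroup ((θ B ⊛ B) n) ((B ⊛ θ B) n) (S n) ⟩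
    4 ℕ.* ((θ B ⊛ B) n ℕ.+ (B ⊛ θ B) n) ℕ.+ 4 ℕ.* S n
      ≡⟨ ≡.cong (λ x → 4 ℕ.* x ℕ.+ 4 ℕ.* S n) (θ-⊛ B B n) ⟩
    4 ℕ.* (n ℕ.* S n) ℕ.+ 4 ℕ.* S n
      ≡⟨ final n (S n) ⟩
    suc n ℕ.* (4 ℕ.* S n) ∎)
    where
    B S : ℕ → ℕ
    B = C 0
    S = B ⊛ B
    T : ℕ
    T = 4 ℕ.* (θ B ⊛ B) n ℕ.+ 2 ℕ.* S n
    expand : ∀ i b → 2 ℕ.* suc (2 ℕ.* i) ℕ.* b ≡ 4 ℕ.* (i ℕ.* b) ℕ.+ 2 ℕ.* b
    expand = solve-∀
    regroup : ∀ x y s → (4 ℕ.* x ℕ.+ 2 ℕ.* s) ℕ.+ (4 ℕ.* y ℕ.+ 2 ℕ.* s) ≡ 4 ℕ.* (x ℕ.+ y) ℕ.+ 4 ℕ.* s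
    regroup = solve-∀
    final : ∀ n s → 4 ℕ.* (n ℕ.* s) ℕ.+ 4 ℕ.* s ≡ suc n ℕ.* (4 ℕ.* s)
    final = solve-∀
    shift : (θ B ⊛ B) (suc n) ≡ T
    shift = begin
      -- The term of index 0 vanishes by computation; the recurrence `C₀-suc` applies to all the
      -- others.
      ((λ i → suc i ℕ.* B (suc i)) ⊛ B) n
        ≡⟨ ⊛-cong (λ i → ≡.trans (C₀-suc i) (expand i (B i))) (λ _ → ≡.refl) n ⟩
      ((λ i → 4 ℕ.* θ B i ℕ.+ 2 ℕ.* B i) ⊛ B) n
        ≡⟨ ⊛-distribʳ (λ i → 4 ℕ.* θ B i) (λ i → 2 ℕ.* B i) B n ⟩
      ((λ i → 4 ℕ.* θ B i) ⊛ B) n ℕ.+ ((λ i → 2 ℕ.* B i) ⊛ B) n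
        ≡⟨ ≡.cong₂ ℕ._+_ (⊛-*ˡ 4 (θ B) B n) (⊛-*ˡ 2 B B n) ⟩
      T ∎

-- Convolution of functions on lists.

module ListConvolution {c ℓ₁ ℓ₂} (𝕜 : HeytingField c ℓ₁ ℓ₂) where

  open HeytingField 𝕜 renaming (Carrier to K)
  open HeytingCommutativeRing heytingCommutativeRing using (commutativeRing)
  open CommutativeRing commutativeRing
    using (commutativeSemiring; rawRing; +-commutativeSemigroup; *-commutativeSemigroup)
  open QuasiSymmetric 𝕜
  open CommutativeSemigroupProperties +-commutativeSemigroup
    using () renaming (interchange to +-interchange)
  open CommutativeSemigroupProperties *-commutativeSemigroup
    using () renaming (x∙yz≈y∙xz to x*yz≈y*xz)
  open import Relation.Binary.Reasoning.Setoid setoid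
  open Solver commutativeSemiring using (solve; _:=_; _:+_; _:*_)

  infixl 7 _⋆_
  _⋆_ : {X : Set} → (List X → K) → (List X → K) → List X → K
  (f ⋆ g) []      = f [] * g []
  (f ⋆ g) (x ∷ α) = f [] * g (x ∷ α) + (f ∘ (x ∷_) ⋆ g) α

  δ : {X : Set} → List X → K
  δ []      = 1#
  δ (_ ∷ _) = 0#

  private variable
    X : Set

  -- Comparing only the splits of α allows equations that are known just for positive lists, as the
  -- pieces of a positive list are positive.
  ⋆-cong-splits : ∀ {f f′ g g′ : List X → K} α →
                  (∀ u v → u ++ v ≡ α → f u * g v ≈ f′ u * g′ v) →
                  (f ⋆ g) α ≈ (f′ ⋆ g′) α
  ⋆-cong-splits []      p = p [] [] ≡.refl
  ⋆-cong-splits (x ∷ α) p = +-cong (p [] (x ∷ α) ≡.refl)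
    (⋆-cong-splits α λ u v eq → p (x ∷ u) v (≡.cong (x ∷_) eq))

  ⋆-cong : ∀ {f f′ g g′ : List X → K} → (∀ u → f u ≈ f′ u) → (∀ v → g v ≈ g′ v) →
           ∀ α → (f ⋆ g) α ≈ (f′ ⋆ g′) α
  ⋆-cong p q α = ⋆-cong-splits α λ u v _ → *-cong (p u) (q v)

  ⋆-distribʳ : ∀ (f f′ g : List X → K) α →
               ((λ u → f u + f′ u) ⋆ g) α ≈ (f ⋆ g) α + (f′ ⋆ g) α
  ⋆-distribʳ f f′ g []      = distribʳ _ _ _
  ⋆-distribʳ f f′ g (x ∷ α) = trans
    (+-cong (distribʳ _ _ _) (⋆-distribʳ (f ∘ (x ∷_)) (f′ ∘ (x ∷_)) g α))
    (+-interchange _ _ _ _)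

  ⋆-*ˡ : ∀ x (f g : List X → K) α → ((λ u → x * f u) ⋆ g) α ≈ x * (f ⋆ g) α
  ⋆-*ˡ x f g []      = *-assoc _ _ _
  ⋆-*ˡ x f g (y ∷ α) =
    trans (+-cong (*-assoc _ _ _) (⋆-*ˡ x (f ∘ (y ∷_)) g α)) (sym (distribˡ _ _ _))

  ⋆-identityˡ : ∀ (g : List X → K) α → (δ ⋆ g) α ≈ g α
  ⋆-identityˡ g []      = *-identityˡ _
  ⋆-identityˡ g (x ∷ α) = begin
    1# * g (x ∷ α) + ((λ _ → 0#) ⋆ g) α
      ≈⟨ +-cong (*-identityˡ _) (⋆-cong (λ _ → sym (zeroˡ 0#)) (λ _ → refl) α) ⟩
    -- Zero is written as a product so that `⋆-*ˡ` can extract a scalar 0.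
    g (x ∷ α) + ((λ _ → 0# * 0#) ⋆ g) α
      ≈⟨ +-congˡ (trans (⋆-*ˡ 0# (λ _ → 0#) g α) (zeroˡ _)) ⟩
    g (x ∷ α) + 0#
      ≈⟨ +-identityʳ _ ⟩
    g (x ∷ α) ∎

  ⋆-identityʳ : ∀ (f : List X → K) α → (f ⋆ δ) α ≈ f α
  ⋆-identityʳ f []      = *-identityʳ _
  ⋆-identityʳ f (x ∷ α) =
    trans (+-cong (zeroʳ _) (⋆-identityʳ (f ∘ (x ∷_)) α)) (+-identityˡ _)

  ⋆-assoc : ∀ (f g h : List X → K) α → (f ⋆ g ⋆ h) α ≈ (f ⋆ (g ⋆ h)) α
  ⋆-assoc f g h []      = *-assoc _ _ _
  ⋆-assoc f g h (x ∷ α) = begin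
    f [] * g [] * h (x ∷ α) + ((λ u → f [] * g (x ∷ u) + (fₓ ⋆ g) u) ⋆ h) α
      ≈⟨ +-congˡ (⋆-distribʳ _ _ h α) ⟩
    f [] * g [] * h (x ∷ α) + (((λ u → f [] * g (x ∷ u)) ⋆ h) α + (fₓ ⋆ g ⋆ h) α)
      ≈⟨ +-cong (*-assoc _ _ _) (+-cong (⋆-*ˡ (f []) _ h α) (⋆-assoc fₓ g h α)) ⟩
    f [] * (g [] * h (x ∷ α)) + (f [] * (g ∘ (x ∷_) ⋆ h) α + (fₓ ⋆ (g ⋆ h)) α)
      ≈⟨ solve 4 (λ a b c d → a :* b :+ (a :* c :+ d) := a :* (b :+ c) :+ d) refl _ _ _ _ ⟩
    f [] * (g ⋆ h) (x ∷ α) + (fₓ ⋆ (g ⋆ h)) α ∎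
    where
    fₓ : _
    fₓ = f ∘ (x ∷_)

  -- Finite sums and sums over compositions.

  ∑-map : ∀ {a b} {A : Set a} {B : Set b} (h : A → B) (f : B → K) xs → ∑ (map h xs) f ≡ ∑ xs (f ∘ h)
  ∑-map h f []       = ≡.refl
  ∑-map h f (x ∷ xs) = ≡.cong (f (h x) +_) (∑-map h f xs)

  ∑-++ : ∀ {a} {A : Set a} (f : A → K) xs ys → ∑ (xs ++ ys) f ≈ ∑ xs f + ∑ ys f
  ∑-++ f []       ys = sym (+-identityˡ _)
  ∑-++ f (x ∷ xs) ys = trans (+-congˡ (∑-++ f xs ys)) (sym (+-assoc _ _ _))

  ∑-concatMap : ∀ {a b} {A : Set a} {B : Set b} (h : A → List B) (f : B → K) xs →
                ∑ (concatMap h xs) f ≈ ∑ xs λ x → ∑ (h x) f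
  ∑-concatMap h f []       = refl
  ∑-concatMap h f (x ∷ xs) =
    trans (∑-++ f (h x) (concatMap h xs)) (+-congˡ (∑-concatMap h f xs))

  ∑-*ˡ : ∀ {a} {A : Set a} x (f : A → K) xs → ∑ xs (λ y → x * f y) ≈ x * ∑ xs f
  ∑-*ˡ x f []       = sym (zeroʳ x)
  ∑-*ˡ x f (y ∷ ys) = trans (+-congˡ (∑-*ˡ x f ys)) (sym (distribˡ _ _ _))

  ∑-zip-mapˡ : {X Y Z : Set} (h : X → Y) (F : Y → Z → K) (xs : List X) (zs : List Z) →
               ∑ (zip (map h xs) zs) (λ (y , z) → F y z) ≡ ∑ (zip xs zs) (λ (x , z) → F (h x) z)
  ∑-zip-mapˡ h F []       zs       = ≡.refl
  ∑-zip-mapˡ h F (x ∷ xs) []       = ≡.refl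
  ∑-zip-mapˡ h F (x ∷ xs) (z ∷ zs) = ≡.cong (F (h x) z +_) (∑-zip-mapˡ h F xs zs)

  ∑-deconcatenations : ∀ (f g : List ℕ → K) α →
    ∑ (deconcatenations α) (λ (β , γ) → f β * g γ) ≈ (f ⋆ g) α
  ∑-deconcatenations f g []      = +-identityʳ _
  ∑-deconcatenations f g (x ∷ α) = +-congˡ (trans
    (reflexive (∑-zip-mapˡ (x ∷_) (λ β γ → f β * g γ) (inits α) (tails α)))
    (∑-deconcatenations (f ∘ (x ∷_)) g α))

  -- The tail of `upTo` is an `applyUpTo` of a shifted function, so the induction needs an arbitrary
  -- `h`.
  ∑-applyUpTo-support : ∀ {a} {A : Set a} (h : ℕ → A) (f : A → K) {k n} → k < n →
    (∀ i → i ≢ k → f (h i) ≈ 0#) → ∑ (applyUpTo h n) f ≈ f (h k)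
  ∑-applyUpTo-support h f {zero} {suc n} _ f≈0 =
    trans (+-congˡ (vanish (h ∘ suc) n λ i → f≈0 (suc i) λ ())) (+-identityʳ _)
    where
    vanish : ∀ h n → (∀ i → f (h i) ≈ 0#) → ∑ (applyUpTo h n) f ≈ 0#
    vanish h zero    f≈0 = refl
    vanish h (suc n) f≈0 =
      trans (+-cong (f≈0 0) (vanish (h ∘ suc) n (f≈0 ∘ suc))) (+-identityˡ 0#)
  ∑-applyUpTo-support h f {suc k} {suc n} (s≤s k<n) f≈0 = trans
    (+-cong (f≈0 0 λ ()) (∑-applyUpTo-support (h ∘ suc) f k<n
      λ i i≢k → f≈0 (suc i) (i≢k ∘ ℕₚ.suc-injective)))
    (+-identityˡ _)

  ∑-upTo-support : ∀ (f : ℕ → K) {k n} → k < n → (∀ i → i ≢ k → f i ≈ 0#) → ∑ (upTo n) f ≈ f k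
  ∑-upTo-support = ∑-applyUpTo-support (λ i → i)

  Positive : List ℕ → Set
  Positive = All (0 <_)

  ∑-compositions-zero : ∀ n (F : List ℕ → K) → (∀ β → β ⊨ n → F β ≈ 0#) → ∑ (compositions n) F ≈ 0#
  ∑-compositions-zero zero    F p = trans (+-identityʳ _) (p [] ([] , ≡.refl))
  ∑-compositions-zero (suc n) F p = trans (∑-concatMap _ F (compositions n))
    (∑-compositions-zero n _ λ where
      []      (_ , eq) → trans (+-identityʳ _) (p [ 1 ] (z<s ∷ [] , ≡.cong suc eq))
      (a ∷ β) (0<a ∷ pos , eq) → trans
        (+-cong (p (1 ∷ a ∷ β) (z<s ∷ 0<a ∷ pos , ≡.cong suc eq))
          (trans (+-identityʳ _) (p (suc a ∷ β) (z<s ∷ pos , ≡.cong suc eq))))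
        (+-identityˡ 0#))

  -- Each composition of n + 1 comes from a single composition of n, by prepending 1 or by
  -- increasing the first part. The clauses find this predecessor of α and show that its other
  -- extension differs from α.
  ∑-compositions-support : ∀ n (F : List ℕ → K) {α} → α ⊨ n →
    (∀ β → Positive β → β ≢ α → F β ≈ 0#) → ∑ (compositions n) F ≈ F α
  ∑-compositions-support zero F {[]} _ _ = +-identityʳ _
  ∑-compositions-support zero F {suc _ ∷ _} (_ , ()) _
  ∑-compositions-support zero F {zero ∷ _} (() ∷ _ , _) _
  ∑-compositions-support (suc n) F {zero ∷ _} (() ∷ _ , _) _
  ∑-compositions-support (suc n) F {suc zero ∷ []} (_ , ≡.refl) F≈0 =
    +-identityʳ _
  ∑-compositions-support (suc n) F {suc zero ∷ b ∷ α} (_ ∷ pos , eq) F≈0 = trans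
    (∑-concatMap _ F (compositions n))
    (trans (∑-compositions-support n _ {b ∷ α} (pos , ℕₚ.suc-injective eq) λ where
        []      _         _  → trans (+-identityʳ _) (F≈0 [ 1 ] (z<s ∷ []) λ ())
        (a ∷ β) (0<a ∷ q) ne → trans
          (+-cong (F≈0 _ (z<s ∷ 0<a ∷ q) (λ { ≡.refl → ne ≡.refl }))
            -- Increasing a gives first part 1 only if a is 0, which positivity excludes.
            (trans (+-identityʳ _) (F≈0 _ (z<s ∷ q) λ { ≡.refl → ℕₚ.n≮0 0<a })))
          (+-identityˡ 0#))
      (trans (+-congˡ (trans (+-identityʳ _)
        (F≈0 _ (z<s ∷ All.tail pos) λ ()))) (+-identityʳ _)))
  ∑-compositions-support (suc n) F {suc (suc a) ∷ α} (_ ∷ pos , eq) F≈0 = trans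
    (∑-concatMap _ F (compositions n))
    (trans (∑-compositions-support n _ {suc a ∷ α} (z<s ∷ pos , ℕₚ.suc-injective eq) λ where
        []      _         _  → trans (+-identityʳ _) (F≈0 [ 1 ] (z<s ∷ []) λ ())
        (b ∷ β) (0<b ∷ q) ne → trans
          (+-cong (F≈0 _ (z<s ∷ 0<b ∷ q) λ ())
            (trans (+-identityʳ _) (F≈0 _ (z<s ∷ q) λ { ≡.refl → ne ≡.refl })))
          (+-identityˡ 0#))
      (trans (+-cong (F≈0 _ (z<s ∷ z<s ∷ pos) λ ()) (+-identityʳ _)) (+-identityˡ _)))

  -- Functionals on the monomial basis.

  nonzeros-positive : ∀ {α} → Positive α → nonzeros α ≡ α
  nonzeros-positive []                    = ≡.refl
  nonzeros-positive {suc _ ∷ _} (_ ∷ pos) = ≡.cong (_ ∷_) (nonzeros-positive pos)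

  coeff-M-≡ : ∀ α e → nonzeros e ≡ α → coeff (M α) e ≈ 1#
  coeff-M-≡ α e eq with ≡-dec ℕ._≟_ (nonzeros e) α
  ... | yes _ = refl
  ... | no ne = contradiction eq ne

  coeff-M-≢ : ∀ α e → nonzeros e ≢ α → coeff (M α) e ≈ 0#
  coeff-M-≢ α e ne with ≡-dec ℕ._≟_ (nonzeros e) α
  ... | yes eq = contradiction eq ne
  ... | no _   = refl

  -- `Δ` runs over all compositions up to the bound, and only the coefficient at α survives. The
  -- left tensor factors are multiples of monomial functions, so `ρ` has to be known on these only;
  -- this covers `bar φ` as well as a character.
  ✶-M : ∀ {ρ ψ} (r : List ℕ → K) → (∀ x β → ρ (x • M β) ≈ x * r β) →
        ∀ {α} → Positive α → (ρ ✶ ψ) (M α) ≈ (r ⋆ (ψ ∘ M)) α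
  ✶-M {ρ} {ψ} r ρ-• {α} pos = begin
    (ρ ✶ ψ) (M α)
      ≈⟨ ∑-concatMap splits F (compositionsUpTo (sum α)) ⟩
    ∑ (compositionsUpTo (sum α)) (λ β → ∑ (splits β) F)
      ≈⟨ ∑-cong (compositionsUpTo (sum α)) term ⟩
    ∑ (compositionsUpTo (sum α)) G
      ≈⟨ ∑-concatMap compositions G (upTo (suc (sum α))) ⟩
    ∑ (upTo (suc (sum α))) (λ d → ∑ (compositions d) G)
      ≈⟨ ∑-upTo-support (λ d → ∑ (compositions d) G) (ℕₚ.n<1+n (sum α)) (λ d d≢ →
           ∑-compositions-zero d G λ β (β-pos , eq) → G≈0 β β-pos λ { ≡.refl → d≢ (≡.sym eq) }) ⟩
    ∑ (compositions (sum α)) G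
      ≈⟨ ∑-compositions-support (sum α) G (pos , ≡.refl) G≈0 ⟩
    G α
      ≈⟨ trans (*-congʳ (coeff-M-≡ α α (nonzeros-positive pos))) (*-identityˡ _) ⟩
    (r ⋆ (ψ ∘ M)) α ∎
    where
    splits : List ℕ → List (QSym × QSym)
    splits α′ = map (λ (β , γ) → coeff (M α) α′ • M β , M γ) (deconcatenations α′)
    F : QSym × QSym → K
    F (g , h) = ρ g * ψ h
    G : List ℕ → K
    G β = coeff (M α) β * (r ⋆ (ψ ∘ M)) β
    G≈0 : ∀ β → Positive β → β ≢ α → G β ≈ 0#
    G≈0 β β-pos β≢α = trans
      (*-congʳ (coeff-M-≢ α β (β≢α ∘ ≡.trans (≡.sym (nonzeros-positive β-pos))))) (zeroˡ _)
    term : ∀ β → ∑ (splits β) F ≈ G β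
    term β = begin
      ∑ (splits β) F
        ≡⟨ ∑-map _ F (deconcatenations β) ⟩
      ∑ (deconcatenations β) (λ (γ , γ′) → ρ (coeff (M α) β • M γ) * ψ (M γ′))
        ≈⟨ ∑-cong (deconcatenations β) (λ (γ , γ′) → trans (*-congʳ (ρ-• _ γ)) (*-assoc _ _ _)) ⟩
      ∑ (deconcatenations β) (λ (γ , γ′) → coeff (M α) β * (r γ * ψ (M γ′)))
        ≈⟨ ∑-*ˡ _ _ (deconcatenations β) ⟩
      coeff (M α) β * ∑ (deconcatenations β) (λ (γ , γ′) → r γ * ψ (M γ′))
        ≈⟨ *-congˡ (∑-deconcatenations r (ψ ∘ M) β) ⟩
      G β ∎

  M-homogeneous : ∀ β e → sum e ≢ sum β → coeff (M β) e ≈ 0#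
  M-homogeneous β e ne = coeff-M-≢ β e λ { ≡.refl → ne (≡.sym (sum-nonzeros e)) }

  module _ {φ : Functional} (character : IsCharacter φ) where
    open IsCharacter character
    open RingMorphisms qsymRawRing rawRing using (module IsRingHomomorphism)
    open IsRingHomomorphism isRingHomomorphism

    character-1 : φ (M []) ≈ 1#
    character-1 = 1#-homo

    -- Only the component of degree n can be nonzero, and n ≤ `bound f` places it in the range of
    -- the sum defining `bar`.
    bar-homogeneous : ∀ n f → n ≤ bound f → (∀ e → sum e ≢ n → coeff f e ≈ 0#) →
                      bar φ f ≈ [-1]^ n * φ f
    bar-homogeneous n f n≤ f-hom = trans
      (∑-upTo-support _ (s≤s n≤) λ i i≢n →
        trans (*-congˡ (trans (⟦⟧-cong (other i i≢n)) 0#-homo)) (zeroʳ _))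
      (*-congˡ (⟦⟧-cong same))
      where
      other : ∀ i → i ≢ n → component i f ≈Q 0Q
      other i i≢n e with sum e ℕ.≟ i
      ... | yes ≡.refl = f-hom e i≢n
      ... | no _       = refl
      same : component n f ≈Q f
      same e with sum e ℕ.≟ n
      ... | yes _ = refl
      ... | no ne = sym (f-hom e ne)

    bar-M : ∀ β → bar φ (M β) ≈ [-1]^ (sum β) * φ (M β)
    bar-M β = bar-homogeneous (sum β) (M β) ℕₚ.≤-refl (M-homogeneous β)

    bar-•-M : ∀ x β → bar φ (x • M β) ≈ x * ([-1]^ (sum β) * φ (M β))
    bar-•-M x β = trans
      (bar-homogeneous (sum β) (x • M β) ℕₚ.≤-refl λ e ne →
        trans (*-congˡ (M-homogeneous β e ne)) (zeroʳ x))
      (trans (*-congˡ (•-homo x (M β))) (x*yz≈y*xz _ _ _))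

  ζᴹ : List ℕ → K
  ζᴹ []      = 1#
  ζᴹ (_ ∷ α) = δ α

  ζ-M : ∀ {α} → Positive α → ζ (M α) ≈ ζᴹ α
  ζ-M {[]}        _ = +-identityʳ 1#
  ζ-M {zero ∷ _}  (() ∷ _)
  ζ-M {suc a ∷ []} _ = trans
    (∑-upTo-support (λ n → coeff (M [ suc a ]) [ n ]) (s≤s (ℕₚ.m≤m+n (suc a) 0))
      λ i i≢ → coeff-M-≢ [ suc a ] [ i ] (off i i≢))
    (coeff-M-≡ [ suc a ] [ suc a ] ≡.refl)
    where
    off : ∀ i → i ≢ suc a → nonzeros [ i ] ≢ [ suc a ]
    off zero    _  ()
    off (suc i) ne ≡.refl = ne ≡.refl
  ζ-M {suc a ∷ b ∷ α} _ = ∑-zero (All.universal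
    (λ i → coeff-M-≢ (suc a ∷ b ∷ α) [ i ] (off i))
    (upTo (suc (sum (suc a ∷ b ∷ α)))))
    where
    off : ∀ i → nonzeros [ i ] ≢ suc a ∷ b ∷ α
    off zero    ()
    off (suc i) ()

-- Counting even and odd parts.

kₑ-even : ∀ {x} α → Even x → kₑ (x ∷ α) ≡ suc (kₑ α)
kₑ-even α ev = ≡.cong length (filter-accept (2 ∣?_) {xs = α} ev)

kₑ-odd : ∀ {x} α → Odd x → kₑ (x ∷ α) ≡ kₑ α
kₑ-odd α od = ≡.cong length (filter-reject (2 ∣?_) {xs = α} od)

kₒ-even : ∀ {x} α → Even x → kₒ (x ∷ α) ≡ kₒ α
kₒ-even α ev = ≡.cong length (filter-reject (λ a → ¬? (2 ∣? a)) {xs = α} λ od → od ev)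

kₒ-odd : ∀ {x} α → Odd x → kₒ (x ∷ α) ≡ suc (kₒ α)
kₒ-odd α od = ≡.cong length (filter-accept (λ a → ¬? (2 ∣? a)) {xs = α} od)

-- Each part has the same parity as its contribution to `kₒ`.
sum+kₒ-even : ∀ α → Even (sum α ℕ.+ kₒ α)
sum+kₒ-even [] = 2 ∣0
sum+kₒ-even (x ∷ α) with 2 ∣? x
... | yes ev = ≡.subst Even
  (≡.trans (≡.sym (ℕₚ.+-assoc x _ _)) (≡.cong (x ℕ.+ sum α ℕ.+_) (≡.sym (kₒ-even α ev))))
  (∣m∣n⇒∣m+n ev (sum+kₒ-even α))
... | no od = ≡.subst Even
  (≡.trans (regroup x (sum α) (kₒ α)) (≡.cong (x ℕ.+ sum α ℕ.+_) (≡.sym (kₒ-odd α od))))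
  (∣m∣n⇒∣m+n (odd+odd od (odd-1+2* 0)) (sum+kₒ-even α))
  where
  regroup : ∀ x s k → x ℕ.+ 1 ℕ.+ (s ℕ.+ k) ≡ x ℕ.+ s ℕ.+ suc k
  regroup = solve-∀

even-sum⇒even-kₒ : ∀ α → Even (sum α) → Even (kₒ α)
even-sum⇒even-kₒ α = ∣m+n∣m⇒∣n (sum+kₒ-even α)

even+odd : ∀ {m n} → Even (m ℕ.+ n) → Odd m → Odd n
even+odd {m} {n} ev od even-n = od (∣m+n∣m⇒∣n (≡.subst Even (ℕₚ.+-comm m n) ev) even-n)

module FormulaProof {c ℓ₁ ℓ₂} (𝕜 : HeytingField c ℓ₁ ℓ₂)
  (2#0 : QuasiSymmetric.Characteristic≢2 𝕜) where

  open HeytingField 𝕜 renaming (Carrier to K)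
  open HeytingCommutativeRing heytingCommutativeRing using (commutativeRing)
  open CommutativeRing commutativeRing
    using (ring; semiring; commutativeSemiring; rawRing; *-commutativeSemigroup)
  open HeytingProperties heytingCommutativeRing using (x-0≈x)
  open QuasiSymmetric 𝕜
  open Halving 2#0
  open RingProperties ring
  open CommutativeSemigroupProperties *-commutativeSemigroup
    using () renaming (interchange to *-interchange)
  open RawSemiringDefs (RawRing.rawSemiring rawRing) using (_^_)
  open Exp semiring using (^-homo-*; ^-assocʳ)
  open Mult semiring using (×-homo-+; ×1-homo-*)
  open CauchyProduct commutativeSemiring
  open ListConvolution 𝕜
  open import Relation.Binary.Reasoning.Setoid setoid
  open Solver commutativeSemiring using (solve; _:=_; _:+_; _:*_)

  -- Signs and powers of one half.

  x-x≈0 : ∀ x → x + - 1# * x ≈ 0#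
  x-x≈0 x = trans (+-congˡ (-1*x≈-x x)) (-‿inverseʳ x)

  -1*-1≈1 : - 1# * - 1# ≈ 1#
  -1*-1≈1 = trans (-1*x≈-x (- 1#)) (-‿involutive 1#)

  [-1]^2* : ∀ m → [-1]^ (2 ℕ.* m) ≈ 1#
  [-1]^2* m = trans (sym (^-assocʳ (- 1#) 2 m)) (go m)
    where
    go : ∀ m → (- 1# * (- 1# * 1#)) ^ m ≈ 1#
    go zero    = refl
    go (suc m) = trans (*-cong (trans (*-congˡ (*-identityʳ _)) -1*-1≈1) (go m)) (*-identityˡ 1#)

  [-1]^even : ∀ {n} → Even n → [-1]^ n ≈ 1#
  [-1]^even ev with even⇒2* ev
  ... | m , ≡.refl = [-1]^2* m

  [-1]^odd : ∀ {n} → Odd n → [-1]^ n ≈ - 1#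
  [-1]^odd od with odd⇒1+2* od
  ... | m , ≡.refl = trans (*-congˡ ([-1]^2* m)) (*-identityʳ _)

  half : K
  half = proj₁ (#⇒invertible 2#0)

  half-spec : half + half ≈ 1#
  half-spec = begin
    half + half              ≈⟨ +-cong (*-identityʳ half) (*-identityʳ half) ⟨
    half * 1# + half * 1#    ≈⟨ distribˡ half 1# 1# ⟨
    -- Apartness of x and y supplies an inverse of x - y, here with y = 0.
    half * (1# + 1#)         ≈⟨ *-congˡ (x-0≈x _) ⟨
    half * (1# + 1# - 0#)    ≈⟨ proj₁ (proj₂ (#⇒invertible 2#0)) ⟩
    1#                       ∎

  half-double : ∀ x → half * (x + x) ≈ x
  half-double x = begin
    half * (x + x)     ≈⟨ solve 2 (λ h x → h :* (x :+ x) := (h :+ h) :* x) refl half x ⟩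
    (half + half) * x  ≈⟨ trans (*-congʳ half-spec) (*-identityˡ x) ⟩
    x                  ∎

  double-injective : ∀ {x y} → x + x ≈ y + y → x ≈ y
  double-injective {x} {y} eq =
    trans (sym (half-double x)) (trans (*-congˡ eq) (half-double y))

  -- Both factors invert 2^n. Powers of the single element `half` make the exponent laws available.
  /2^-half : ∀ x n → x /2^ n ≈ x * half ^ n
  /2^-half x n = *-congˡ (begin
    inv                       ≈⟨ *-identityʳ inv ⟨
    inv * 1#                  ≈⟨ *-congˡ (2^*half^ n) ⟨
    inv * (2^n * half ^ n)    ≈⟨ *-assoc _ _ _ ⟨
    inv * 2^n * half ^ n      ≈⟨ *-congʳ (*-congˡ (x-0≈x 2^n)) ⟨
    inv * (2^n - 0#) * half ^ n ≈⟨ *-congʳ (proj₁ (proj₂ (#⇒invertible (2^n#0 n)))) ⟩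
    1# * half ^ n             ≈⟨ *-identityˡ _ ⟩
    half ^ n                  ∎)
    where
    inv 2^n : K
    inv = proj₁ (#⇒invertible (2^n#0 n))
    2^n = (1# + 1#) ^ n
    2^*half^ : ∀ n → (1# + 1#) ^ n * half ^ n ≈ 1#
    2^*half^ zero    = *-identityˡ 1#
    2^*half^ (suc n) = begin
      (1# + 1#) * (1# + 1#) ^ n * (half * half ^ n)    ≈⟨ *-interchange _ _ _ _ ⟩
      (1# + 1#) * half * ((1# + 1#) ^ n * half ^ n)    ≈⟨ *-cong (trans (*-comm _ _) (half-double 1#)) (2^*half^ n) ⟩
      1# * 1#                                          ≈⟨ *-identityˡ 1# ⟩
      1#                                               ∎

  -- The series with coefficients C(0,m) / 4^m.

  quarter : K
  quarter = half ^ 2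

  fromℕ-4* : ∀ k → fromℕ (4 ℕ.* k) * quarter ≈ fromℕ k
  fromℕ-4* k = begin
    fromℕ (4 ℕ.* k) * quarter
      ≈⟨ *-congʳ (trans (reflexive (≡.cong fromℕ (four k)))
           (trans (×-homo-+ 1# (k ℕ.+ k) _) (+-cong (×-homo-+ 1# k k) (×-homo-+ 1# k k)))) ⟩
    (fromℕ k + fromℕ k + (fromℕ k + fromℕ k)) * (half * (half * 1#))
      ≈⟨ solve 3 (λ h x o → (x :+ x :+ (x :+ x)) :* (h :* (h :* o)) :=
                            (h :+ h) :* ((h :+ h) :* o) :* x) refl half (fromℕ k) 1# ⟩
    (half + half) * ((half + half) * 1#) * fromℕ k
      ≈⟨ *-congʳ (trans (*-cong half-spec (trans (*-identityʳ _) half-spec)) (*-identityˡ _)) ⟩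
    1# * fromℕ k
      ≈⟨ *-identityˡ _ ⟩
    fromℕ k ∎
    where
    four : ∀ k → 4 ℕ.* k ≡ (k ℕ.+ k) ℕ.+ (k ℕ.+ k)
    four = solve-∀

  -- The coefficients of (1 - t)^(-1/2).
  c₀ : ℕ → K
  c₀ m = fromℕ (C 0 m) /2^ (2 ℕ.* m)

  c₀-quarter : ∀ m → c₀ m ≈ fromℕ (C 0 m) * quarter ^ m
  c₀-quarter m = trans (/2^-half _ (2 ℕ.* m)) (*-congˡ (sym (^-assocʳ half 2 m)))

  fromℕ-⊛ : ∀ f g n → fromℕ (ℕ-CauchyProduct._⊛_ f g n) ≈ (fromℕ ∘ f ⊛ fromℕ ∘ g) n
  fromℕ-⊛ f g zero    = ×1-homo-* (f 0) (g 0)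
  fromℕ-⊛ f g (suc n) = trans (×-homo-+ 1# (f 0 ℕ.* g (suc n)) _)
    (+-cong (×1-homo-* (f 0) (g (suc n))) (fromℕ-⊛ (f ∘ suc) g n))

  c₀⊛c₀ : ∀ n → (c₀ ⊛ c₀) n ≈ 1#
  c₀⊛c₀ n = begin
    (c₀ ⊛ c₀) n
      ≈⟨ ⊛-cong c₀-quarter c₀-quarter n ⟩
    ((λ i → fromℕ (C 0 i) * quarter ^ i) ⊛ (λ i → fromℕ (C 0 i) * quarter ^ i)) n
      ≈⟨ ⊛-^ quarter _ _ n ⟩
    (fromℕ ∘ C 0 ⊛ fromℕ ∘ C 0) n * quarter ^ n
      ≈⟨ *-congʳ (fromℕ-⊛ (C 0) (C 0) n) ⟨
    fromℕ (S n) * quarter ^ n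
      ≈⟨ normalised n ⟩
    1# ∎
    where
    S : ℕ → ℕ
    S = ℕ-CauchyProduct._⊛_ (C 0) (C 0)
    normalised : ∀ n → fromℕ (S n) * quarter ^ n ≈ 1#
    normalised zero    = trans (*-identityʳ _) (+-identityʳ _)
    normalised (suc n) = begin
      fromℕ (S (suc n)) * (quarter * quarter ^ n)
        ≈⟨ *-congʳ (reflexive (≡.cong fromℕ (C₀⊛C₀-suc n))) ⟩
      fromℕ (4 ℕ.* S n) * (quarter * quarter ^ n)
        ≈⟨ *-assoc _ _ _ ⟨
      fromℕ (4 ℕ.* S n) * quarter * quarter ^ n
        ≈⟨ *-congʳ (fromℕ-4* (S n)) ⟩
      fromℕ (S n) * quarter ^ n
        ≈⟨ normalised n ⟩
      1# ∎

  -- As series, f = (1 - t) p(t²) and g = (1 + t) q(t²), so f g = (1 - t²) (p q)(t²). The induction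
  -- removes two coefficients of f and one of p.
  ⊛-alternating : ∀ {f g p q : ℕ → K} →
    (∀ i → f (2 ℕ.* i) ≈ p i) → (∀ i → f (suc (2 ℕ.* i)) ≈ - 1# * p i) →
    (∀ i → g (2 ℕ.* i) ≈ q i) → (∀ i → g (suc (2 ℕ.* i)) ≈ q i) →
    ∀ m → (f ⊛ g) (2 ℕ.* suc m) + (p ⊛ q) m ≈ (p ⊛ q) (suc m)
  ⊛-alternating {f} {g} {p} {q} f₀ f₁ g₀ g₁ zero = begin
    f 0 * g 2 + (f 1 * g 1 + f 2 * g 0) + p 0 * q 0
      ≈⟨ +-congʳ (+-cong (*-cong (f₀ 0) (g₀ 1)) (+-cong (*-cong (f₁ 0) (g₁ 0)) (*-cong (f₀ 1) (g₀ 0)))) ⟩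
    p 0 * q 1 + (- 1# * p 0 * q 0 + p 1 * q 0) + p 0 * q 0
      ≈⟨ solve 5 (λ m a b c d → a :* b :+ (m :* a :* c :+ d) :+ a :* c :=
                                a :* b :+ d :+ (a :* c :+ m :* (a :* c))) refl (- 1#) (p 0) (q 1) (q 0) _ ⟩
    p 0 * q 1 + p 1 * q 0 + (p 0 * q 0 + - 1# * (p 0 * q 0))
      ≈⟨ trans (+-congˡ (x-x≈0 _)) (+-identityʳ _) ⟩
    p 0 * q 1 + p 1 * q 0 ∎
  ⊛-alternating {f} {g} {p} {q} f₀ f₁ g₀ g₁ (suc m) = begin
    (f ⊛ g) (2 ℕ.* suc (suc m)) + (p ⊛ q) (suc m)
      ≈⟨ +-congʳ (reflexive (≡.cong (f ⊛ g) (ℕₚ.*-suc 2 (suc m)))) ⟩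
    f 0 * g (suc (suc (2 ℕ.* suc m))) + (f 1 * g (suc (2 ℕ.* suc m)) + X) + (p ⊛ q) (suc m)
      ≈⟨ +-congʳ (+-cong (*-cong (f₀ 0) (trans (reflexive (≡.cong g (≡.sym (ℕₚ.*-suc 2 (suc m))))) (g₀ (suc (suc m)))))
                         (+-congʳ (*-cong (f₁ 0) (g₁ (suc m))))) ⟩
    p 0 * q (suc (suc m)) + (- 1# * p 0 * q (suc m) + X) + (p 0 * q (suc m) + Y)
      ≈⟨ solve 6 (λ m a b c x y → a :* b :+ (m :* a :* c :+ x) :+ (a :* c :+ y) :=
                                a :* b :+ (x :+ y) :+ (a :* c :+ m :* (a :* c)))
           refl (- 1#) (p 0) (q (suc (suc m))) (q (suc m)) X Y ⟩
    p 0 * q (suc (suc m)) + (X + Y) + (p 0 * q (suc m) + - 1# * (p 0 * q (suc m)))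
      ≈⟨ trans (+-congˡ (x-x≈0 _)) (+-identityʳ _) ⟩
    p 0 * q (suc (suc m)) + (X + Y)
      ≈⟨ +-congˡ (⊛-alternating {f ∘ suc ∘ suc} {g} {p ∘ suc} {q}
           (λ i → trans (reflexive (≡.cong f (≡.sym (ℕₚ.*-suc 2 i)))) (f₀ (suc i)))
           (λ i → trans (reflexive (≡.cong (f ∘ suc) (≡.sym (ℕₚ.*-suc 2 i)))) (f₁ (suc i)))
           g₀ g₁ m) ⟩
    (p ⊛ q) (suc (suc m)) ∎
    where
    X Y : K
    X = (f ∘ suc ∘ suc ⊛ g) (2 ℕ.* suc m)
    Y = (p ∘ suc ⊛ q) m

  -- The series d(t) and its lift to compositions.

  d : ℕ → K
  d k = c₀ (k / 2)

  d̄ : ℕ → K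
  d̄ k = [-1]^ k * d k

  d-2* : ∀ m → d (2 ℕ.* m) ≈ c₀ m
  d-2* m = reflexive (≡.cong c₀ (2*m/2≡m m))

  d-1+2* : ∀ m → d (suc (2 ℕ.* m)) ≈ c₀ m
  d-1+2* m = reflexive (≡.cong c₀ ([1+2*m]/2≡m m))

  d-suc : ∀ {k} → Even k → d (suc k) ≈ d k
  d-suc ev with even⇒2* ev
  ... | m , ≡.refl = trans (d-1+2* m) (sym (d-2* m))

  -- With c(t) = (1 - t)^(-1/2), the series d(t) is (1 + t) c(t²), a square root of (1 + t)/(1 - t),
  -- and `d̄` is d(-t). Hence `⊛-alternating` applies with p = q = `c₀`.
  d̄⊛d : ∀ m → (d̄ ⊛ d) (2 ℕ.* suc m) ≈ 0#
  d̄⊛d m = +-cancelʳ 1# _ _ (begin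
    (d̄ ⊛ d) (2 ℕ.* suc m) + 1#            ≈⟨ +-congˡ (c₀⊛c₀ m) ⟨
    (d̄ ⊛ d) (2 ℕ.* suc m) + (c₀ ⊛ c₀) m   ≈⟨ ⊛-alternating {d̄} {d}
      (λ i → trans (*-cong ([-1]^2* i) (d-2* i)) (*-identityˡ _))
      (λ i → *-cong ([-1]^odd (odd-1+2* i)) (d-1+2* i)) d-2* d-1+2* m ⟩
    (c₀ ⊛ c₀) (suc m)                      ≈⟨ c₀⊛c₀ (suc m) ⟩
    1#                                     ≈⟨ +-identityˡ 1# ⟨
    0# + 1#                                ∎)

  d-0 : d 0 ≈ 1#
  d-0 = trans (c₀-quarter 0) (trans (*-identityʳ _) (+-identityʳ _))

  -- The algebra map of the header, with the series ∑ e k t^k given by its coefficients.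
  lift : (ℕ → K) → List ℕ → K
  lift e []      = e 0
  lift e (x ∷ α) with 2 ∣? x
  ... | yes _ = e 0 * δ α + - 1# * lift e α
  ... | no _  = lift (e ∘ suc) α

  lift-even : ∀ e {x} α → Even x → lift e (x ∷ α) ≈ e 0 * δ α + - 1# * lift e α
  lift-even e {x} α ev with 2 ∣? x
  ... | yes _ = refl
  ... | no od = contradiction ev od

  lift-odd : ∀ e {x} α → Odd x → lift e (x ∷ α) ≈ lift (e ∘ suc) α
  lift-odd e {x} α od with 2 ∣? x
  ... | yes ev = contradiction ev od
  ... | no _   = refl

  lift-linear : ∀ x f g α → lift (λ n → x * f n + g n) α ≈ x * lift f α + lift g α
  lift-linear x f g []      = refl
  lift-linear x f g (y ∷ α) with 2 ∣? y
  ... | yes _ = trans (+-congˡ (*-congˡ (lift-linear x f g α)))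
    (solve 7 (λ x a b δ m s t → (x :* a :+ b) :* δ :+ m :* (x :* s :+ t) :=
                               x :* (a :* δ :+ m :* s) :+ (b :* δ :+ m :* t))
      refl x (f 0) (g 0) (δ α) (- 1#) (lift f α) (lift g α))
  ... | no _  = lift-linear x (f ∘ suc) (g ∘ suc) α

  -- Induction on the list: an odd first part shifts the series, as in the recursion of the Cauchy
  -- product; at an even first part the cross terms `e 0 * F` and their negatives cancel.
  lift-⋆ : ∀ e f α → (lift e ⋆ lift f) α ≈ lift (e ⊛ f) α
  lift-⋆ e f []      = refl
  lift-⋆ e f (x ∷ α) with 2 ∣? x
  ... | no _  = trans (+-congˡ (lift-⋆ (e ∘ suc) f α)) (sym (lift-linear _ _ _ α))
  ... | yes _ = begin
    e 0 * (f 0 * δ α + - 1# * F) + ((λ u → e 0 * δ u + - 1# * lift e u) ⋆ lift f) α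
      ≈⟨ +-congˡ (trans (⋆-distribʳ _ _ (lift f) α)
          (+-cong (trans (⋆-*ˡ (e 0) δ (lift f) α) (*-congˡ (⋆-identityˡ (lift f) α)))
                  (trans (⋆-*ˡ (- 1#) (lift e) (lift f) α) (*-congˡ (lift-⋆ e f α))))) ⟩
    e 0 * (f 0 * δ α + - 1# * F) + (e 0 * F + - 1# * lift (e ⊛ f) α)
      ≈⟨ solve 6 (λ a b δ m f g → a :* (b :* δ :+ m :* f) :+ (a :* f :+ m :* g) :=
                  a :* b :* δ :+ m :* g :+ a :* (f :+ m :* f))
           refl (e 0) (f 0) (δ α) (- 1#) F (lift (e ⊛ f) α) ⟩
    e 0 * f 0 * δ α + - 1# * lift (e ⊛ f) α + e 0 * (F + - 1# * F)
      ≈⟨ trans (+-congˡ (trans (*-congˡ (x-x≈0 F)) (zeroʳ _))) (+-identityʳ _) ⟩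
    e 0 * f 0 * δ α + - 1# * lift (e ⊛ f) α ∎
    where
    F : K
    F = lift f α

  -- At a final even part the term with `δ` cancels the negated constant coefficient; the parts
  -- before it preserve this zero.
  lift-last-even : ∀ e α → LastPart Even α → lift e α ≈ 0#
  lift-last-even e (x ∷ []) (Maybe.just ev) =
    trans (lift-even e [] ev) (trans (+-congʳ (*-identityʳ _)) (x-x≈0 (e 0)))
  -- The induction hypothesis is kept for all series, since an odd x replaces e by `e ∘ suc`.
  lift-last-even e (x ∷ β@(_ ∷ _)) last-even = go (2 ∣? x) λ e′ → lift-last-even e′ β last-even
    where
    go : Dec (Even x) → (∀ e′ → lift e′ β ≈ 0#) → lift e (x ∷ β) ≈ 0#
    go (yes ev) ih = trans (lift-even e β ev)
      (trans (+-cong (zeroʳ _) (trans (*-congˡ (ih e)) (zeroʳ _))) (+-identityˡ 0#))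
    go (no od)  ih = trans (lift-odd e β od) (ih (e ∘ suc))

  -- Each even part changes the sign, the term with `δ` being zero before a nonempty rest, and each
  -- odd part advances the index by one.
  lift-last-odd : ∀ e α → LastPart Odd α → lift e α ≈ [-1]^ (kₑ α) * e (kₒ α)
  lift-last-odd e (x ∷ []) (Maybe.just od) = begin
    lift e [ x ]                  ≈⟨ lift-odd e [] od ⟩
    e 1                           ≈⟨ *-identityˡ _ ⟨
    1# * e 1                      ≡⟨ ≡.cong₂ (λ i j → [-1]^ i * e j) (kₑ-odd [] od) (kₒ-odd [] od) ⟨
    [-1]^ (kₑ [ x ]) * e (kₒ [ x ]) ∎
  lift-last-odd e (x ∷ β@(_ ∷ _)) last-odd = go (2 ∣? x) λ e′ → lift-last-odd e′ β last-odd
    where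
    go : Dec (Even x) → (∀ e′ → lift e′ β ≈ [-1]^ (kₑ β) * e′ (kₒ β)) →
         lift e (x ∷ β) ≈ [-1]^ (kₑ (x ∷ β)) * e (kₒ (x ∷ β))
    go (yes ev) ih = begin
      lift e (x ∷ β)                       ≈⟨ lift-even e β ev ⟩
      e 0 * 0# + - 1# * lift e β           ≈⟨ trans (+-congʳ (zeroʳ _)) (+-identityˡ _) ⟩
      - 1# * lift e β                      ≈⟨ *-congˡ (ih e) ⟩
      - 1# * ([-1]^ (kₑ β) * e (kₒ β))     ≈⟨ *-assoc _ _ _ ⟨
      [-1]^ (suc (kₑ β)) * e (kₒ β)        ≡⟨ ≡.cong₂ (λ i j → [-1]^ i * e j) (kₑ-even β ev) (kₒ-even β ev) ⟨
      [-1]^ (kₑ (x ∷ β)) * e (kₒ (x ∷ β))  ∎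
    go (no od) ih = begin
      lift e (x ∷ β)                       ≈⟨ lift-odd e β od ⟩
      lift (e ∘ suc) β                     ≈⟨ ih (e ∘ suc) ⟩
      [-1]^ (kₑ β) * e (suc (kₒ β))        ≡⟨ ≡.cong₂ (λ i j → [-1]^ i * e j) (kₑ-odd β od) (kₒ-odd β od) ⟨
      [-1]^ (kₑ (x ∷ β)) * e (kₒ (x ∷ β))  ∎

  lastPart? : ∀ x α → LastPart Even (x ∷ α) ⊎ LastPart Odd (x ∷ α)
  lastPart? x [] with 2 ∣? x
  ... | yes ev = inj₁ (Maybe.just ev)
  ... | no od  = inj₂ (Maybe.just od)
  lastPart? x (y ∷ α) = lastPart? y α

  -- In the closed forms for both parities of the last part, the series enters at most through its
  -- coefficient of index `kₒ α`.
  lift-cong-kₒ : ∀ e f α → e (kₒ α) ≈ f (kₒ α) → lift e α ≈ lift f α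
  lift-cong-kₒ e f []      eq = eq
  lift-cong-kₒ e f (x ∷ α) eq with lastPart? x α
  ... | inj₁ ev = trans (lift-last-even e (x ∷ α) ev) (sym (lift-last-even f (x ∷ α) ev))
  ... | inj₂ od = trans (lift-last-odd e (x ∷ α) od)
    (trans (*-congˡ eq) (sym (lift-last-odd f (x ∷ α) od)))

  -- The sign twist by degree.

  twist : (List ℕ → K) → List ℕ → K
  twist f α = [-1]^ (sum α) * f α

  -- The degree is additive under concatenation.
  twist-⋆ : ∀ f g α → twist (f ⋆ g) α ≈ (twist f ⋆ twist g) α
  twist-⋆ f g α = trans (sym (⋆-*ˡ _ f g α)) (⋆-cong-splits α λ u v eq → begin
    [-1]^ (sum α) * f u * g v
      ≈⟨ *-congʳ (*-congʳ (trans
           (reflexive (≡.cong [-1]^_ (≡.trans (≡.cong sum (≡.sym eq)) (sum-++ u v))))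
           (^-homo-* (- 1#) (sum u) (sum v)))) ⟩
    [-1]^ (sum u) * [-1]^ (sum v) * f u * g v
      ≈⟨ trans (*-assoc _ _ _) (*-interchange _ _ _ _) ⟩
    twist f u * twist g v ∎)

  -- The map `lift` carries t ↦ -t to `twist`. The scalar s absorbs the factor -1 that the shift at
  -- an odd part produces.
  lift-twist : ∀ s e f → (∀ k → f k ≈ s * ([-1]^ k * e k)) →
               ∀ α → lift f α ≈ s * twist (lift e) α
  lift-twist s e f eq []      = eq 0
  lift-twist s e f eq (x ∷ α) with 2 ∣? x
  ... | no od = begin
    lift (f ∘ suc) α
      ≈⟨ lift-twist (s * - 1#) (e ∘ suc) (f ∘ suc) (λ k → trans (eq (suc k)) (shift _ _)) α ⟩
    s * - 1# * ([-1]^ (sum α) * lift (e ∘ suc) α)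
      ≈⟨ shift _ _ ⟨
    s * (- 1# * [-1]^ (sum α) * lift (e ∘ suc) α)
      ≈⟨ *-congˡ (*-congʳ (trans (^-homo-* (- 1#) x (sum α)) (*-congʳ ([-1]^odd od)))) ⟨
    s * ([-1]^ (x ℕ.+ sum α) * lift (e ∘ suc) α) ∎
    where
    shift : ∀ a b → s * (- 1# * a * b) ≈ s * - 1# * (a * b)
    shift = solve 4 (λ s m a b → s :* (m :* a :* b) := s :* m :* (a :* b)) refl s (- 1#)
  ... | yes ev = begin
    f 0 * δ α + - 1# * lift f α
      ≈⟨ +-cong (trans (*-congʳ (trans (eq 0) (*-congˡ (*-identityˡ _)))) (δ-twist α))
                (*-congˡ (lift-twist s e f eq α)) ⟩
    s * ([-1]^ (sum α) * (e 0 * δ α)) + - 1# * (s * ([-1]^ (sum α) * lift e α))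
      ≈⟨ solve 5 (λ s t a m b → s :* (t :* a) :+ m :* (s :* (t :* b)) := s :* (t :* (a :+ m :* b)))
           refl s ([-1]^ (sum α)) (e 0 * δ α) (- 1#) (lift e α) ⟩
    s * ([-1]^ (sum α) * (e 0 * δ α + - 1# * lift e α))
      ≈⟨ *-congˡ (*-congʳ (trans (^-homo-* (- 1#) x (sum α))
           (trans (*-congʳ ([-1]^even ev)) (*-identityˡ _)))) ⟨
    s * ([-1]^ (x ℕ.+ sum α) * (e 0 * δ α + - 1# * lift e α)) ∎
    where
    δ-twist : ∀ β → s * e 0 * δ β ≈ s * ([-1]^ (sum β) * (e 0 * δ β))
    δ-twist []      = trans (*-assoc _ _ _) (*-congˡ (sym (*-identityˡ _)))
    δ-twist (_ ∷ _) = trans (zeroʳ _)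
      (sym (trans (*-congˡ (trans (*-congˡ (zeroʳ _)) (zeroʳ _))) (zeroʳ _)))

  -- The equations hold for the formula.

  A : List ℕ → K
  A = lift d

  -- If x is odd, then α has even degree, so `kₒ α` is even and `d` takes equal values there and at
  -- the next index. If x is even, then α is nonempty and prepending x negates `A α`.
  A-tail : ∀ x α → Odd (x ℕ.+ sum α) → A (x ∷ α) + [-1]^ x * A α ≈ 0#
  A-tail x α odd-sum with 2 ∣? x
  ... | no od = trans
    (+-cong (lift-cong-kₒ (d ∘ suc) d α (d-suc even-kₒ)) (*-congʳ ([-1]^odd od)))
    (x-x≈0 _)
    where
    even-kₒ : Even (kₒ α)
    even-kₒ with 2 ∣? kₒ α
    ... | yes ev = ev
    ... | no odd-kₒ = contradiction (odd+odd od (even+odd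
      (≡.subst Even (ℕₚ.+-comm (sum α) (kₒ α)) (sum+kₒ-even α)) odd-kₒ)) odd-sum
  A-tail x [] odd-sum | yes ev = contradiction (≡.subst Even (≡.sym (ℕₚ.+-identityʳ x)) ev) odd-sum
  A-tail x α@(_ ∷ _) odd-sum | yes ev = trans
    (+-cong (trans (+-congʳ (zeroʳ _)) (+-identityˡ _)) (trans (*-congʳ ([-1]^even ev)) (*-identityˡ _)))
    (trans (+-comm _ _) (x-x≈0 _))

  -- Through `lift-⋆` this concerns one coefficient of d(-t) d(t). Even degree makes its index `kₒ`
  -- even, and an odd last part makes it positive; an even last part gives 0 at once.
  A-odd : ∀ x α → Even (x ℕ.+ sum α) → (twist A ⋆ A) (x ∷ α) ≈ 0#
  A-odd x α even-sum = begin
    (twist A ⋆ A) (x ∷ α)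
      ≈⟨ ⋆-cong (λ u → sym (trans (lift-twist 1# d d̄ (λ k → sym (*-identityˡ _)) u) (*-identityˡ _)))
           (λ _ → refl) (x ∷ α) ⟩
    (lift d̄ ⋆ lift d) (x ∷ α)
      ≈⟨ lift-⋆ d̄ d (x ∷ α) ⟩
    lift (d̄ ⊛ d) (x ∷ α)
      ≈⟨ vanish (lastPart? x α) ⟩
    0# ∎
    where
    vanish : LastPart Even (x ∷ α) ⊎ LastPart Odd (x ∷ α) → lift (d̄ ⊛ d) (x ∷ α) ≈ 0#
    vanish (inj₁ ev) = lift-last-even _ (x ∷ α) ev
    vanish (inj₂ od) = trans (lift-last-odd _ (x ∷ α) od) (trans (*-congˡ coefficient) (zeroʳ _))
      where
      kₒ-pos : ∀ β → LastPart Odd β → 0 < kₒ β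
      kₒ-pos (y ∷ []) (Maybe.just od) = ≡.subst (0 <_) (≡.sym (kₒ-odd [] od)) z<s
      kₒ-pos (y ∷ γ@(_ ∷ _)) od with kₒ-pos γ od | 2 ∣? y
      ... | p | yes ev = ≡.subst (0 <_) (≡.sym (kₒ-even γ ev)) p
      ... | p | no od′ = ≡.subst (0 <_) (≡.sym (kₒ-odd γ od′)) z<s
      coefficient : (d̄ ⊛ d) (kₒ (x ∷ α)) ≈ 0#
      coefficient with even⇒2* (even-sum⇒even-kₒ (x ∷ α) even-sum)
      ... | zero  , eq = contradiction (≡.subst (0 <_) eq (kₒ-pos (x ∷ α) od)) λ ()
      ... | suc m , eq = trans (reflexive (≡.cong (d̄ ⊛ d) eq)) (d̄⊛d m)

  -- Uniqueness of the solution.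

  -- The terms of f ⋆ g whose second factor is nonempty.
  infixl 7 _⋆⁻_
  _⋆⁻_ : (List ℕ → K) → (List ℕ → K) → List ℕ → K
  (f ⋆⁻ g) []      = 0#
  (f ⋆⁻ g) (x ∷ α) = f [] * g (x ∷ α) + (f ∘ (x ∷_) ⋆⁻ g) α

  ⋆-last : ∀ f g α → (f ⋆ g) α ≈ (f ⋆⁻ g) α + f α * g []
  ⋆-last f g []      = sym (+-identityˡ _)
  ⋆-last f g (x ∷ α) = trans (+-congˡ (⋆-last (f ∘ (x ∷_)) g α)) (sym (+-assoc _ _ _))

  ⋆⁻-cong-splits : ∀ {f f′ g g′} α → (∀ u y v → u ++ y ∷ v ≡ α → f u * g (y ∷ v) ≈ f′ u * g′ (y ∷ v)) →
                   (f ⋆⁻ g) α ≈ (f′ ⋆⁻ g′) α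
  ⋆⁻-cong-splits []      p = refl
  ⋆⁻-cong-splits (x ∷ α) p = +-cong (p [] x α ≡.refl)
    (⋆⁻-cong-splits α λ u y v eq → p (x ∷ u) y v (≡.cong (x ∷_) eq))

  -- The two splits with an empty factor each contribute `a (x ∷ α)`, the sign being 1 in even
  -- degree; the remaining terms involve only shorter lists.
  twist⋆-ends : ∀ a x α → a [] ≈ 1# → Even (x ℕ.+ sum α) →
    (twist a ⋆ a) (x ∷ α) ≈ (a (x ∷ α) + a (x ∷ α)) + (twist a ∘ (x ∷_) ⋆⁻ a) α
  twist⋆-ends a x α a₀ ev = begin
    1# * a [] * a (x ∷ α) + (twist a ∘ (x ∷_) ⋆ a) α
      ≈⟨ +-cong (trans (*-congʳ (trans (*-identityˡ _) a₀)) (*-identityˡ _))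
           (trans (⋆-last _ a α) (+-congˡ
             (trans (*-cong (trans (*-congʳ ([-1]^even ev)) (*-identityˡ _)) a₀) (*-identityʳ _)))) ⟩
    a (x ∷ α) + ((twist a ∘ (x ∷_) ⋆⁻ a) α + a (x ∷ α))
      ≈⟨ trans (+-congˡ (+-comm _ _)) (sym (+-assoc _ _ _)) ⟩
    (a (x ∷ α) + a (x ∷ α)) + (twist a ∘ (x ∷_) ⋆⁻ a) α ∎

  -- `✶-M` gives the equations for genuine compositions only, hence the positivity in both
  -- assumptions.
  module _ (a : List ℕ → K) (a₀ : a [] ≈ 1#)
    (a-tail : ∀ x α → Positive (x ∷ α) → Odd (x ℕ.+ sum α) → a (x ∷ α) + [-1]^ x * a α ≈ 0#)
    (a-odd : ∀ x α → Positive (x ∷ α) → (twist a ⋆ a) (x ∷ α) ≈ 0#) where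

    -- The bound on the length makes the recursion structural although it visits both pieces of
    -- every proper split.
    ≈A-bounded : ∀ n α → length α ≤ n → Positive α → a α ≈ A α
    ≈A-bounded n       []      _         _   = trans a₀ (sym d-0)
    ≈A-bounded (suc n) (x ∷ α) (s≤s |α|≤n) pos with 2 ∣? (x ℕ.+ sum α)
    ... | no odd-sum = +-cancelʳ _ _ _ (begin
      a (x ∷ α) + [-1]^ x * a α  ≈⟨ a-tail x α pos odd-sum ⟩
      0#                         ≈⟨ A-tail x α odd-sum ⟨
      A (x ∷ α) + [-1]^ x * A α  ≈⟨ +-congˡ (*-congˡ (≈A-bounded n α |α|≤n (All.tail pos))) ⟨
      A (x ∷ α) + [-1]^ x * a α  ∎)
    ... | yes even-sum = double-injective (+-cancelʳ _ _ _ (begin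
      a (x ∷ α) + a (x ∷ α) + (twist a ∘ (x ∷_) ⋆⁻ a) α  ≈⟨ twist⋆-ends a x α a₀ even-sum ⟨
      (twist a ⋆ a) (x ∷ α)                              ≈⟨ a-odd x α pos ⟩
      0#                                                 ≈⟨ A-odd x α even-sum ⟨
      (twist A ⋆ A) (x ∷ α)                              ≈⟨ twist⋆-ends A x α d-0 even-sum ⟩
      A (x ∷ α) + A (x ∷ α) + (twist A ∘ (x ∷_) ⋆⁻ A) α  ≈⟨ +-congˡ (⋆⁻-cong-splits α shorter) ⟨
      A (x ∷ α) + A (x ∷ α) + (twist a ∘ (x ∷_) ⋆⁻ a) α  ∎))
      where
      shorter : ∀ u y v → u ++ y ∷ v ≡ α → twist a (x ∷ u) * a (y ∷ v) ≈ twist A (x ∷ u) * A (y ∷ v)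
      shorter u y v ≡.refl with ++⁻ u (All.tail pos)
      ... | u-pos , yv-pos = *-cong
        -- The list `x ∷ u` is no longer than α because the other piece has at least the part y.
        (*-congˡ (≈A-bounded n (x ∷ u) (ℕₚ.≤-trans u-short |α|≤n) (All.head pos ∷ u-pos)))
        (≈A-bounded n (y ∷ v) (ℕₚ.≤-trans yv-short |α|≤n) yv-pos)
        where
        u-short : suc (length u) ≤ length (u ++ y ∷ v)
        u-short = ≡.subst (suc (length u) ≤_)
          (≡.trans (≡.sym (ℕₚ.+-suc (length u) (length v))) (≡.sym (length-++ u)))
          (s≤s (ℕₚ.m≤m+n (length u) (length v)))
        yv-short : length (y ∷ v) ≤ length (u ++ y ∷ v)
        yv-short = ≡.subst (length (y ∷ v) ≤_) (≡.sym (length-++ u)) (ℕₚ.m≤n+m _ (length u))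

    ≈A : ∀ {α} → Positive α → a α ≈ A α
    ≈A {α} = ≈A-bounded (length α) α ℕₚ.≤-refl

  -- The even and odd parts of ζ on the monomial basis.

  module Factorization {ζ₊ ζ₋ : Functional} (fact : IsEvenOddFactorization ζ ζ₊ ζ₋) where
    open IsEvenOddFactorization fact

    a b : List ℕ → K
    a = ζ₋ ∘ M
    b = ζ₊ ∘ M

    twist-b : ∀ α → twist b α ≈ b α
    twist-b α = trans (sym (bar-M character₊ α)) (even (M α))

    ζᴹ≈b⋆a : ∀ {α} → Positive α → ζᴹ α ≈ (b ⋆ a) α
    ζᴹ≈b⋆a {α} pos = trans (sym (ζ-M pos)) (trans (factorization (M α))
      (✶-M {ζ₊} {ζ₋} b (λ x β → IsCharacter.•-homo character₊ x (M β)) pos))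

    twist-a⋆a≈δ : ∀ {α} → Positive α → (twist a ⋆ a) α ≈ δ α
    twist-a⋆a≈δ {α} pos = trans
      (sym (✶-M {bar ζ₋} {ζ₋} (twist a) (bar-•-M character₋) pos))
      (trans (proj₁ odd (M α)) (ε-M α))
      where
      ε-M : ∀ β → ε (M β) ≈ δ β
      ε-M []      = refl
      ε-M (_ ∷ _) = refl

    twist-ζᴹ⋆a≈b : ∀ {α} → Positive α → (twist ζᴹ ⋆ a) α ≈ b α
    twist-ζᴹ⋆a≈b {α} pos = begin
      (twist ζᴹ ⋆ a) α
        ≈⟨ ⋆-cong-splits α (λ u v eq → *-congʳ (twist-ζᴹ (positiveˡ u v eq))) ⟩
      (b ⋆ twist a ⋆ a) α
        ≈⟨ ⋆-assoc b (twist a) a α ⟩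
      (b ⋆ (twist a ⋆ a)) α
        ≈⟨ ⋆-cong-splits α (λ u v eq → *-congˡ (twist-a⋆a≈δ (positiveʳ u v eq))) ⟩
      (b ⋆ δ) α
        ≈⟨ ⋆-identityʳ b α ⟩
      b α ∎
      where
      positiveˡ : ∀ u v → u ++ v ≡ α → Positive u
      positiveˡ u v ≡.refl = proj₁ (++⁻ u pos)
      positiveʳ : ∀ u v → u ++ v ≡ α → Positive v
      positiveʳ u v ≡.refl = proj₂ (++⁻ u pos)
      twist-ζᴹ : ∀ {u} → Positive u → twist ζᴹ u ≈ (b ⋆ twist a) u
      twist-ζᴹ {u} u-pos = trans (*-congˡ (ζᴹ≈b⋆a u-pos))
        (trans (twist-⋆ b a u) (⋆-cong twist-b (λ _ → refl) u))

    -- Since `ζᴹ` vanishes on lists with two or more parts, only the empty prefix and the prefix x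
    -- contribute.
    b-∷ : ∀ x α → Positive (x ∷ α) → b (x ∷ α) ≈ a (x ∷ α) + [-1]^ x * a α
    b-∷ x α pos = begin
      b (x ∷ α)
        ≈⟨ twist-ζᴹ⋆a≈b pos ⟨
      1# * 1# * a (x ∷ α) + (twist ζᴹ ∘ (x ∷_) ⋆ a) α
        ≈⟨ +-cong (trans (*-congʳ (*-identityˡ 1#)) (*-identityˡ _))
             (⋆-cong concentrated (λ _ → refl) α) ⟩
      a (x ∷ α) + ((λ u → [-1]^ x * δ u) ⋆ a) α
        ≈⟨ +-congˡ (trans (⋆-*ˡ _ δ a α) (*-congˡ (⋆-identityˡ a α))) ⟩
      a (x ∷ α) + [-1]^ x * a α ∎
      where
      concentrated : ∀ u → twist ζᴹ (x ∷ u) ≈ [-1]^ x * δ u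
      concentrated []      = *-congʳ (reflexive (≡.cong [-1]^_ (ℕₚ.+-identityʳ x)))
      concentrated (_ ∷ _) = trans (zeroʳ _) (sym (zeroʳ _))

    -- Evenness of ζ₊ makes the value equal to its own negative, and 2 is invertible.
    b-odd-sum : ∀ α → Odd (sum α) → b α ≈ 0#
    b-odd-sum α odd-sum = double-injective (begin
      b α + b α         ≈⟨ +-congˡ (twist-b α) ⟨
      b α + twist b α   ≈⟨ trans (+-congˡ (*-congʳ ([-1]^odd odd-sum))) (x-x≈0 (b α)) ⟩
      0#                ≈⟨ +-identityˡ 0# ⟨
      0# + 0#           ∎)

    a-lift : ∀ {α} → Positive α → a α ≈ A α
    a-lift = ≈A a (character-1 character₋)
      (λ x α pos odd-sum → trans (sym (b-∷ x α pos)) (b-odd-sum (x ∷ α) odd-sum))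
      (λ x α pos → twist-a⋆a≈δ pos)

    b-lift : ∀ x α → Positive (x ∷ α) → b (x ∷ α) ≈ A (x ∷ α) + [-1]^ x * A α
    b-lift x α pos = trans (b-∷ x α pos)
      (+-cong (a-lift pos) (*-congˡ (a-lift (All.tail pos))))

    -- Closed forms of the values.

    a-last-odd : ∀ {α} → Positive α → LastPart Odd α →
      a α ≈ ([-1]^ (kₑ α) * fromℕ (C 0 (kₒ α / 2))) /2^ (2 ℕ.* (kₒ α / 2))
    a-last-odd {α} pos od = trans (a-lift pos) (trans (lift-last-odd d α od) (sym (*-assoc _ _ _)))

    a-last-even : ∀ {α} → Positive α → LastPart Even α → a α ≈ 0#
    a-last-even {α} pos ev = trans (a-lift pos) (lift-last-even d α ev)

    -- The two copies of `A α` cancel. What remains gives 1 on a single even part and 0 when more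
    -- parts follow.
    b-even-head : ∀ {x} α → Positive (x ∷ α) → Even x → b (x ∷ α) ≈ δ α
    b-even-head {x} α pos ev = begin
      b (x ∷ α)
        ≈⟨ b-lift x α pos ⟩
      A (x ∷ α) + [-1]^ x * A α
        ≈⟨ +-cong (lift-even d α ev) (trans (*-congʳ ([-1]^even ev)) (*-identityˡ _)) ⟩
      d 0 * δ α + - 1# * A α + A α
        ≈⟨ trans (+-assoc _ _ _) (+-cong (trans (*-congʳ d-0) (*-identityˡ _))
             (trans (+-comm _ _) (x-x≈0 _))) ⟩
      δ α + 0#
        ≈⟨ +-identityʳ _ ⟩
      δ α ∎

    b-odd-head : ∀ {x} α → Positive (x ∷ α) → Odd x → b (x ∷ α) ≈ lift (d ∘ suc) α + - 1# * A α
    b-odd-head {x} α pos od = trans (b-lift x α pos)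
      (+-cong (lift-odd d α od) (*-congʳ ([-1]^odd od)))

    -- Over the common denominator 4^(m + 1) this is C(0,m + 1) - 4 C(0,m) = -C(1,m), from `C₁+C₀`.
    d-step : ∀ m → d (2 ℕ.* suc m) + - 1# * d (suc (2 ℕ.* m)) ≈
             - 1# * (fromℕ (C 1 m) * half ^ (2 ℕ.* suc m))
    d-step m = begin
      d (2 ℕ.* suc m) + - 1# * d (suc (2 ℕ.* m))
        ≈⟨ +-cong (trans (d-2* (suc m)) (/2^-half _ (2 ℕ.* suc m)))
             (*-congˡ (trans (d-1+2* m) previous)) ⟩
      B′ * h + - 1# * ((fromℕ (C 1 m) + B′) * h)
        ≈⟨ solve 4 (λ b h m c → b :* h :+ m :* ((c :+ b) :* h) :=
                               m :* (c :* h) :+ (b :* h :+ m :* (b :* h))) refl B′ h (- 1#) _ ⟩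
      - 1# * (fromℕ (C 1 m) * h) + (B′ * h + - 1# * (B′ * h))
        ≈⟨ trans (+-congˡ (x-x≈0 _)) (+-identityʳ _) ⟩
      - 1# * (fromℕ (C 1 m) * h) ∎
      where
      B′ h : K
      B′ = fromℕ (C 0 (suc m))
      h  = half ^ (2 ℕ.* suc m)
      previous : c₀ m ≈ (fromℕ (C 1 m) + B′) * h
      previous = begin
        c₀ m
          ≈⟨ c₀-quarter m ⟩
        fromℕ (C 0 m) * quarter ^ m
          ≈⟨ *-congʳ (fromℕ-4* (C 0 m)) ⟨
        fromℕ (4 ℕ.* C 0 m) * quarter * quarter ^ m
          ≈⟨ *-assoc _ _ _ ⟩
        fromℕ (4 ℕ.* C 0 m) * quarter ^ suc m
          ≈⟨ *-cong (trans (reflexive (≡.cong fromℕ (≡.sym (C₁+C₀ m)))) (×-homo-+ 1# (C 1 m) _))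
               (^-assocʳ half 2 (suc m)) ⟩
        (fromℕ (C 1 m) + B′) * h ∎

    -- Even degree and an odd first part force `kₒ` of the tail to be 2m + 1, so `d-step` evaluates
    -- the difference of the two lifts. Then `kₒ α / 2` is m + 1 and the subtraction of 1 is not
    -- truncated.
    b-odd-ends : ∀ {α} → Positive α → FirstPart Odd α → LastPart Odd α → Even (sum α) →
      b α ≈ ([-1]^ (suc (kₑ α)) * fromℕ (C 1 (kₒ α / 2 ∸ 1))) /2^ (kₒ α)
    b-odd-ends {x ∷ []} pos (Maybe.just od) _ ev =
      contradiction (≡.subst Even (ℕₚ.+-identityʳ x) ev) od
    b-odd-ends {x ∷ β@(_ ∷ _)} pos (Maybe.just od) last-odd ev
      with odd⇒1+2* (even-suc⇒odd (≡.subst Even (kₒ-odd β od) (even-sum⇒even-kₒ (x ∷ β) ev)))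
    ... | m , kₒβ = begin
      b (x ∷ β)
        ≈⟨ b-odd-head β pos od ⟩
      lift (d ∘ suc) β + - 1# * A β
        ≈⟨ +-cong (lift-last-odd (d ∘ suc) β last-odd) (*-congˡ (lift-last-odd d β last-odd)) ⟩
      s * d (suc (kₒ β)) + - 1# * (s * d (kₒ β))
        ≈⟨ solve 4 (λ s x m y → s :* x :+ m :* (s :* y) := s :* (x :+ m :* y)) refl s _ (- 1#) _ ⟩
      s * (d (suc (kₒ β)) + - 1# * d (kₒ β))
        ≈⟨ *-congˡ (reflexive (≡.cong₂ (λ i j → d i + - 1# * d j)
             (≡.trans (≡.sym (kₒ-odd β od)) kₒα) kₒβ)) ⟩
      s * (d (2 ℕ.* suc m) + - 1# * d (suc (2 ℕ.* m)))
        ≈⟨ *-congˡ (d-step m) ⟩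
      s * (- 1# * (fromℕ (C 1 m) * half ^ (2 ℕ.* suc m)))
        ≈⟨ solve 4 (λ s m c h → s :* (m :* (c :* h)) := m :* s :* c :* h) refl s (- 1#) _ _ ⟩
      - 1# * s * fromℕ (C 1 m) * half ^ (2 ℕ.* suc m)
        ≡⟨ ≡.cong₂ (λ i j → [-1]^ (suc i) * fromℕ (C 1 j) * half ^ (2 ℕ.* suc m))
             (kₑ-odd β od) (≡.trans (≡.cong (λ k → k / 2 ∸ 1) kₒα) (≡.cong (_∸ 1) (2*m/2≡m (suc m)))) ⟨
      [-1]^ (suc (kₑ (x ∷ β))) * fromℕ (C 1 (kₒ (x ∷ β) / 2 ∸ 1)) * half ^ (2 ℕ.* suc m)
        ≡⟨ ≡.cong (λ k → [-1]^ (suc (kₑ (x ∷ β))) * fromℕ (C 1 (kₒ (x ∷ β) / 2 ∸ 1)) * half ^ k) kₒα ⟨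
      [-1]^ (suc (kₑ (x ∷ β))) * fromℕ (C 1 (kₒ (x ∷ β) / 2 ∸ 1)) * half ^ kₒ (x ∷ β)
        ≈⟨ /2^-half _ (kₒ (x ∷ β)) ⟨
      ([-1]^ (suc (kₑ (x ∷ β))) * fromℕ (C 1 (kₒ (x ∷ β) / 2 ∸ 1))) /2^ (kₒ (x ∷ β)) ∎
      where
      s : K
      s = [-1]^ (kₑ β)
      kₒα : kₒ (x ∷ β) ≡ 2 ℕ.* suc m
      kₒα = ≡.trans (kₒ-odd β od) (≡.trans (≡.cong suc kₒβ) (≡.sym (ℕₚ.*-suc 2 m)))

    -- Three cases remain: odd degree; an even first part followed by others; an odd first part with
    -- an even last part, where both lifts in `b-odd-head` vanish.
    b-otherwise : ∀ {n α} → 0 < n → α ⊨ n →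
      ¬ (FirstPart Odd α × LastPart Odd α × Even n) → ¬ (α ≡ n ∷ [] × Even n) → b α ≈ 0#
    b-otherwise {n} {α} 0<n (pos , ≡.refl) _ _ with 2 ∣? n
    b-otherwise {n} {α} 0<n (pos , ≡.refl) _ _ | no odd-n = b-odd-sum α odd-n
    b-otherwise {n} {[]} () _ _ _ | yes even-n
    b-otherwise {n} {x ∷ α} _ (pos , ≡.refl) ¬odd-ends ¬single | yes even-n with 2 ∣? x
    b-otherwise {n} {x ∷ []} _ (pos , ≡.refl) ¬odd-ends ¬single | yes even-n | yes ev =
      contradiction (≡.cong [_] (≡.sym (ℕₚ.+-identityʳ x)) , even-n) ¬single
    b-otherwise {n} {x ∷ β@(_ ∷ _)} _ (pos , ≡.refl) ¬odd-ends ¬single | yes even-n | yes ev =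
      b-even-head β pos ev
    b-otherwise {n} {x ∷ []} _ (pos , ≡.refl) ¬odd-ends ¬single | yes even-n | no od =
      contradiction (≡.subst Even (ℕₚ.+-identityʳ x) even-n) od
    b-otherwise {n} {x ∷ y ∷ α} _ (pos , ≡.refl) ¬odd-ends ¬single | yes even-n | no od
      with lastPart? y α
    ... | inj₂ last-odd = contradiction (Maybe.just od , last-odd , even-n) ¬odd-ends
    ... | inj₁ last-even = trans (b-odd-head (y ∷ α) pos od) (trans
      (+-cong (lift-last-even (d ∘ suc) (y ∷ α) last-even)
        (trans (*-congˡ (lift-last-even d (y ∷ α) last-even)) (zeroʳ _)))
      (+-identityˡ 0#))

    b-single : ∀ {n} → 0 < n → Even n → b (n ∷ []) ≈ 1#
    b-single 0<n ev = b-even-head [] (0<n ∷ []) ev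

theorem3p2 : ∀ {c ℓ₁ ℓ₂} (𝕜 : HeytingField c ℓ₁ ℓ₂) →
  let open HeytingField 𝕜
      open QuasiSymmetric 𝕜 in
  (2#0 : Characteristic≢2) →
  let open Halving 2#0 in
  (ζ₊ ζ₋ : Functional) → IsEvenOddFactorization ζ ζ₊ ζ₋ →
  (∀ (n : ℕ) (α : List ℕ) → 0 < n → α ⊨ n →
    (LastPart Odd α →
      ζ₋ (M α) ≈ ([-1]^ (kₑ α) * fromℕ (C 0 (kₒ α / 2))) /2^ (2 · (kₒ α / 2)))
    × (LastPart Even α → ζ₋ (M α) ≈ 0#)
    × (FirstPart Odd α → LastPart Odd α → Even n →
      ζ₊ (M α) ≈ ([-1]^ (suc (kₑ α)) * fromℕ (C 1 (kₒ α / 2 ∸ 1))) /2^ (kₒ α))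
    × (α ≡ n ∷ [] → Even n → ζ₊ (M α) ≈ 1#)
    × (¬ (FirstPart Odd α × LastPart Odd α × Even n) → ¬ (α ≡ n ∷ [] × Even n) →
      ζ₊ (M α) ≈ 0#))
  × ζ₋ 1Q ≈ 1# × ζ₊ 1Q ≈ 1#
theorem3p2 𝕜 2#0 ζ₊ ζ₋ fact =
  (λ n α 0<n (pos , sum≡n) →
      a-last-odd pos
    , a-last-even pos
    , (λ first-odd last-odd even-n →
         b-odd-ends pos first-odd last-odd (≡.subst Even (≡.sym sum≡n) even-n))
    , (λ { ≡.refl → b-single 0<n })
    , b-otherwise 0<n (pos , sum≡n))
  , character-1 character₋
  , character-1 character₊
  where
  open QuasiSymmetric 𝕜 using (module IsEvenOddFactorization)
  open ListConvolution 𝕜 using (character-1)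
  open FormulaProof.Factorization 𝕜 2#0 fact
  open IsEvenOddFactorization fact
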